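{- Let $c$ and $z$ be complex numbers and let $n$ be a positive integer. Then \[ \sum_{\pi \in \mathcal{D}(n)} (-1)^{\#(\pi)-1} \sum_{j=1}^{s(\pi)} \bigl(\ell(\pi) - s(\pi) + j\bigr)^z\, c^{\ell(\pi) - s(\pi) + j} = \sigma_{z,c}(n), \] where $\sigma_{z,c}(n) = \sum_{d \mid n} d^z c^d$.
   Context: For a positive integer $n$, $\mathcal{D}(n)$ denotes the set of all partitions of $n$ into distinct parts. For a partition $\pi$: $s(\pi)$ is its smallest part, $\ell(\pi)$ its largest part, and $\#(\pi)$ its number of parts. For a positive integer $m$ and complex $z$, $m^z = e^{z\log m}$ with the real logarithm. The sum $\sum_{d\mid n}$ runs over the positive divisors $d$ of $n$. -}

module Defs where

open import Algebra.Bundles.Raw using (RawRing)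
import Algebra.Definitions.RawSemiring as RawSemiringDefs
open import Data.Integer.Base as ℤ using (+_)
import Data.Integer.Properties as ℤ
open import Data.List.Base using (List; []; _∷_; _++_; map; filter; foldr; length; applyUpTo; applyDownFrom)
open import Data.List.Extrema.Nat using (min; max)
open import Data.List.Membership.Propositional using (_∈_)
open import Data.List.Membership.Propositional.Properties using (∈-map⁺; ∈-map⁻; ∈-++⁺ˡ; ∈-++⁺ʳ; ∈-++⁻; ∈-filter⁺; ∈-filter⁻)
open import Data.List.Relation.Unary.All as All using (All; []; _∷_)
open import Data.List.Relation.Unary.AllPairs using (AllPairs; []; _∷_)
open import Data.List.Relation.Unary.Any using (here)
open import Data.List.Relation.Unary.Unique.Propositional using (Unique)
import Data.List.Relation.Unary.Unique.Propositional.Properties as Unique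
import Data.List.Properties as List
open import Data.Nat.Base as ℕ using (ℕ; zero; suc)
open import Data.Nat.ListAction using (sum)
open import Data.Nat.Divisibility using (_∣?_)
import Data.Nat.Properties as ℕ
open import Data.Product.Base using (∃; ∃-syntax; _×_; _,_; proj₁; proj₂)
open import Data.Rational.Base using (ℚ; mkℚ; 0ℚ; 1ℚ; ½; _+_; _*_; -_; _-_; _/_; 1/_; _≤_; _<_; *≤*; ∣_∣; NonNegative; Positive; toℚᵘ; positive; nonNegative; +-*-rawSemiring)
open import Data.Rational.Properties
open import Data.Rational.Solver using (module +-*-Solver)
import Data.Rational.Unnormalised.Base as ℚᵘ
import Data.Rational.Unnormalised.Properties as ℚᵘ
open import Data.Sum.Base using (inj₁; inj₂)
open import Function.Bundles using (_⇔_; mk⇔)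
open RawSemiringDefs +-*-rawSemiring using () renaming (_^_ to _^ℚ_)
open import Level using (0ℓ)
open import Relation.Binary.PropositionalEquality
open import Relation.Nullary.Negation.Core using (¬_; contradiction)

------------------------------------------------------------------------
-- Real numbers: Cauchy sequences of rationals, up to null sequences

IsCauchy : (ℕ → ℚ) → Set
IsCauchy s = ∀ ε → 0ℚ < ε → ∃[ N ] (∀ m n → N ℕ.≤ m → N ℕ.≤ n → ∣ s m - s n ∣ < ε)

record ℝ : Set where
  constructor real
  field
    seq    : ℕ → ℚ
    cauchy : IsCauchy seq

open ℝ public

infix 4 _≈ℝ_

_≈ℝ_ : ℝ → ℝ → Set
x ≈ℝ y = ∀ ε → 0ℚ < ε → ∃[ N ] (∀ n → N ℕ.≤ n → ∣ seq x n - seq y n ∣ < ε)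

open +-*-Solver using (solve; _:+_; _:*_; _:-_; :-_; _:=_; con)

module RationalLemmas where

  ι : ℕ → ℚ
  ι n = + n / 1

  /-*-cancel : ∀ a b → (+ a / suc b) * ι (suc b) ≡ ι a
  /-*-cancel a b = toℚᵘ-injective
    (ℚᵘ.≃-trans (toℚᵘ-homo-* (+ a / suc b) (ι (suc b)))
    (ℚᵘ.≃-trans (ℚᵘ.*-cong (toℚᵘ-fromℚᵘ (ℚᵘ.mkℚᵘ (+ a) b)) (toℚᵘ-fromℚᵘ (ℚᵘ.mkℚᵘ (+ suc b) 0)))
    (ℚᵘ.≃-trans (ℚᵘ.*≡* eq) (ℚᵘ.≃-sym (toℚᵘ-fromℚᵘ (ℚᵘ.mkℚᵘ (+ a) 0))))))
    where
    eq : (+ a ℤ.* + suc b) ℤ.* + 1 ≡ + a ℤ.* + (suc b ℕ.* 1)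
    eq = trans (ℤ.*-identityʳ _) (cong (λ k → + a ℤ.* + k) (sym (ℕ.*-identityʳ (suc b))))

  ι-suc : ∀ n → ι (suc n) ≡ 1ℚ + ι n
  ι-suc n = toℚᵘ-injective
    (ℚᵘ.≃-trans (toℚᵘ-fromℚᵘ (ℚᵘ.mkℚᵘ (+ suc n) 0))
    (ℚᵘ.≃-trans (ℚᵘ.*≡* eq)
    (ℚᵘ.≃-trans (ℚᵘ.+-congʳ (toℚᵘ 1ℚ) (ℚᵘ.≃-sym (toℚᵘ-fromℚᵘ (ℚᵘ.mkℚᵘ (+ n) 0))))
    (ℚᵘ.≃-sym (toℚᵘ-homo-+ 1ℚ (ι n))))))
    where
    eq : + suc n ℤ.* + 1 ≡ (+ 1 ℤ.* + 1 ℤ.+ + n ℤ.* + 1) ℤ.* + 1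
    eq = cong (ℤ._* + 1) (cong (λ k → + 1 ℤ.+ k) (sym (ℤ.*-identityʳ (+ n))))

  0≤/ : ∀ a b → 0ℚ ≤ + a / suc b
  0≤/ a b = nonNegative⁻¹ _ {{normalize-nonNeg a (suc b)}}

  0<ι : ∀ n → 0ℚ < ι (suc n)
  0<ι n = positive⁻¹ _ {{normalize-pos (suc n) 1}}

  mulˡ : ∀ {a b c} → 0ℚ ≤ c → a ≤ b → c * a ≤ c * b
  mulˡ {c = c} 0≤c = *-monoˡ-≤-nonNeg c {{nonNegative 0≤c}}

  mulʳ : ∀ {a b c} → 0ℚ ≤ c → a ≤ b → a * c ≤ b * c
  mulʳ {c = c} 0≤c = *-monoʳ-≤-nonNeg c {{nonNegative 0≤c}}

  mul≥0 : ∀ {a b} → 0ℚ ≤ a → 0ℚ ≤ b → 0ℚ ≤ a * b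
  mul≥0 {a} {b} 0≤a 0≤b = subst (_≤ a * b) (*-zeroʳ a) (mulˡ 0≤a 0≤b)

  add≥0 : ∀ {a b} → 0ℚ ≤ a → 0ℚ ≤ b → 0ℚ ≤ a + b
  add≥0 = +-mono-≤

  ≤+ʳ : ∀ {a b} → 0ℚ ≤ b → a ≤ a + b
  ≤+ʳ {a} {b} 0≤b = subst (_≤ a + b) (+-identityʳ a) (+-monoʳ-≤ a 0≤b)

  ≤+ˡ : ∀ {a b} → 0ℚ ≤ b → a ≤ b + a
  ≤+ˡ {a} {b} 0≤b = subst (_≤ b + a) (+-identityˡ a) (+-monoˡ-≤ a 0≤b)

  -- a + b ≤ c gives b ≤ c - a.
  ≤-move : ∀ {a b c} → a + b ≤ c → b ≤ c - a
  ≤-move {a} {b} {c} h = subst (_≤ c - a)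
    (solve 2 (λ a b → a :+ b :- a := b) refl a b) (+-monoˡ-≤ (- a) h)

  ½*½ : ∀ ε → ½ * ε + ½ * ε ≡ ε
  ½*½ ε = trans (sym (*-distribʳ-+ ε ½ ½)) (*-identityˡ ε)

  0<½ : ∀ {ε} → 0ℚ < ε → 0ℚ < ½ * ε
  0<½ {ε} 0<ε = subst (_< ½ * ε) (*-zeroʳ ½) (*-monoʳ-<-pos ½ 0<ε)

  ½< : ∀ {ε} → 0ℚ < ε → ½ * ε < ε
  ½< {ε} 0<ε = subst₂ _<_ (+-identityʳ (½ * ε)) (½*½ ε) (+-monoʳ-< (½ * ε) (0<½ 0<ε))

  quot : ∀ B {ε} → 0ℚ < B → 0ℚ < ε → ∃[ δ ] (0ℚ < δ × B * δ ≡ ε)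
  quot B {ε} 0<B 0<ε = ε * (1/ B) , lt , eq
    where
    instance
      posB = positive 0<B
      nzB  = pos⇒nonZero B
    lt : 0ℚ < ε * (1/ B)
    lt = positive⁻¹ _ {{pos*pos⇒pos ε {{positive 0<ε}} (1/ B) {{1/pos⇒pos B}}}}
    eq : B * (ε * (1/ B)) ≡ ε
    eq = trans (solve 3 (λ b e i → b :* (e :* i) := e :* (b :* i)) refl B ε (1/ B))
      (trans (cong (ε *_) (*-inverseʳ B)) (*-identityʳ ε))

  p≤ι : ∀ p → ∃[ n ] p ≤ ι (suc n)
  p≤ι p@(mkℚ a d-1 _) = ℤ.∣ a ∣ , toℚᵘ-cancel-≤
    (ℚᵘ.≤-respʳ-≃ (ℚᵘ.≃-sym (toℚᵘ-fromℚᵘ (ℚᵘ.mkℚᵘ (+ suc ℤ.∣ a ∣) 0))) (ℚᵘ.*≤* le))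
    where
    a≤∣a∣ : ∀ i → i ℤ.≤ + ℤ.∣ i ∣
    a≤∣a∣ (+ n)      = ℤ.≤-refl
    a≤∣a∣ ℤ.-[1+ n ] = ℤ.-≤+
    le : a ℤ.* + 1 ℤ.≤ + suc ℤ.∣ a ∣ ℤ.* + suc d-1
    le = ℤ.≤-trans (ℤ.≤-reflexive (ℤ.*-identityʳ a)) (ℤ.≤-trans (a≤∣a∣ a)
      (ℤ.≤-trans (ℤ.+≤+ (ℕ.≤-trans (ℕ.n≤1+n _) (ℕ.m≤m*n (suc ℤ.∣ a ∣) (suc d-1)))) ℤ.≤-refl))

  archimedean : ∀ p {q} → 0ℚ < q → ∃[ n ] p ≤ ι (suc n) * q
  archimedean p {q} 0<q = n , ≤-trans (≤-reflexive eq) (mulʳ (<⇒≤ 0<q) (proj₂ b))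
    where
    instance
      posq = positive 0<q
      nzq  = pos⇒nonZero q
    b = p≤ι (p * (1/ q))
    n = proj₁ b
    eq : p ≡ p * (1/ q) * q
    eq = sym (trans (*-assoc p (1/ q) q) (trans (cong (p *_) (*-inverseˡ q)) (*-identityʳ p)))

  ∣-∣-sym : ∀ p q → ∣ p - q ∣ ≡ ∣ q - p ∣
  ∣-∣-sym p q = trans (sym (∣-p∣≡∣p∣ (p - q)))
    (cong ∣_∣ (solve 2 (λ p q → :- (p :- q) := q :- p) refl p q))

  ∣-∣-triangle : ∀ p q r → ∣ p - r ∣ ≤ ∣ p - q ∣ + ∣ q - r ∣
  ∣-∣-triangle p q r = subst (λ e → ∣ e ∣ ≤ ∣ p - q ∣ + ∣ q - r ∣)
    (solve 3 (λ p q r → (p :- q) :+ (q :- r) := p :- r) refl p q r)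
    (∣p+q∣≤∣p∣+∣q∣ (p - q) (q - r))

  cauchy-from-tails : ∀ s → (∀ ε → 0ℚ < ε → ∃[ N ] (∀ n → N ℕ.≤ n → ∣ s n - s N ∣ ≤ ε)) → IsCauchy s
  cauchy-from-tails s h ε 0<ε = N , λ m n N≤m N≤n → ≤-<-trans
    (≤-trans (∣-∣-triangle (s m) (s N) (s n))
      (≤-trans (+-mono-≤ (b m N≤m) (subst (_≤ _) (∣-∣-sym (s n) (s N)) (b n N≤n)))
        (≤-reflexive (½*½ (½ * ε)))))
    (½< 0<ε)
    where
    t = h (½ * (½ * ε)) (0<½ (0<½ 0<ε))
    N = proj₁ t
    b = proj₂ t

  partialSum : (ℕ → ℚ) → ℕ → ℚ
  partialSum t zero    = 0ℚ
  partialSum t (suc n) = partialSum t n + t n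

  term≤partialSum : ∀ t → (∀ k → 0ℚ ≤ t k) → ∀ {i n} → i ℕ.≤ n → t i ≤ partialSum t (suc n)
  partialSum≥0 : ∀ t → (∀ k → 0ℚ ≤ t k) → ∀ n → 0ℚ ≤ partialSum t n
  partialSum≥0 t 0≤t zero    = ≤-refl
  partialSum≥0 t 0≤t (suc n) = add≥0 (partialSum≥0 t 0≤t n) (0≤t n)
  term≤partialSum t 0≤t {n = n} i≤n with ℕ.m≤n⇒m<n∨m≡n i≤n
  ... | inj₂ refl = ≤+ˡ (partialSum≥0 t 0≤t n)
  term≤partialSum t 0≤t {n = suc n} _ | inj₁ (ℕ.s≤s i≤n) =
    ≤-trans (term≤partialSum t 0≤t i≤n) (≤+ʳ (0≤t (suc n)))

  bounded : ∀ x → ∃[ B ] (0ℚ < B × (∀ n → ∣ seq x n ∣ ≤ B))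
  bounded x = A + 1ℚ , <-≤-trans (positive⁻¹ 1ℚ) (≤+ˡ 0≤A) , bnd
    where
    c = cauchy x 1ℚ (positive⁻¹ 1ℚ)
    N = proj₁ c
    a : ℕ → ℚ
    a n = ∣ seq x n ∣
    0≤a : ∀ n → 0ℚ ≤ a n
    0≤a n = 0≤∣p∣ (seq x n)
    A = partialSum a (suc N)
    0≤A = partialSum≥0 a 0≤a (suc N)
    bnd : ∀ n → ∣ seq x n ∣ ≤ A + 1ℚ
    bnd n with ℕ.≤-total n N
    ... | inj₁ n≤N = ≤-trans (term≤partialSum a 0≤a n≤N) (≤+ʳ (<⇒≤ (positive⁻¹ 1ℚ)))
    ... | inj₂ N≤n = ≤-trans
      (subst (λ e → ∣ e ∣ ≤ ∣ seq x N ∣ + ∣ seq x n - seq x N ∣)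
        (solve 2 (λ p q → p :+ (q :- p) := q) refl (seq x N) (seq x n))
        (∣p+q∣≤∣p∣+∣q∣ (seq x N) (seq x n - seq x N)))
      (+-mono-≤ (term≤partialSum a 0≤a (ℕ.≤-refl {N})) (<⇒≤ (proj₂ c n N N≤n ℕ.≤-refl)))

open RationalLemmas

ℚ⇒ℝ : ℚ → ℝ
ℚ⇒ℝ q = real (λ _ → q) λ ε 0<ε → 0 , λ _ _ _ _ → subst (_< ε) (sym (cong ∣_∣ (+-inverseʳ q))) 0<ε

infix  8 -ℝ_
infixl 7 _*ℝ_
infixl 6 _+ℝ_ _-ℝ_

_+ℝ_ : ℝ → ℝ → ℝ
seq    (x +ℝ y) n = seq x n + seq y n
cauchy (x +ℝ y) ε 0<ε = proj₁ cx ℕ.⊔ proj₁ cy , λ m n N≤m N≤n → ≤-<-trans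
    (subst (λ e → ∣ e ∣ ≤ ∣ seq x m - seq x n ∣ + ∣ seq y m - seq y n ∣)
      (solve 4 (λ a b c d → (a :- b) :+ (c :- d) := (a :+ c) :- (b :+ d)) refl
        (seq x m) (seq x n) (seq y m) (seq y n))
      (∣p+q∣≤∣p∣+∣q∣ (seq x m - seq x n) (seq y m - seq y n)))
    (subst (∣ seq x m - seq x n ∣ + ∣ seq y m - seq y n ∣ <_) (½*½ ε)
      (+-mono-< (proj₂ cx m n (ℕ.m⊔n≤o⇒m≤o _ _ N≤m) (ℕ.m⊔n≤o⇒m≤o _ _ N≤n))
                (proj₂ cy m n (ℕ.m⊔n≤o⇒n≤o _ _ N≤m) (ℕ.m⊔n≤o⇒n≤o _ _ N≤n))))
  where
  cx = cauchy x (½ * ε) (0<½ 0<ε)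
  cy = cauchy y (½ * ε) (0<½ 0<ε)

-ℝ_ : ℝ → ℝ
seq    (-ℝ x) n = - seq x n
cauchy (-ℝ x) ε 0<ε = proj₁ cx , λ m n N≤m N≤n → subst (_< ε)
    (trans (sym (∣-p∣≡∣p∣ (seq x m - seq x n))) (cong ∣_∣ (neg-distrib-+ (seq x m) (- seq x n))))
    (proj₂ cx m n N≤m N≤n)
  where cx = cauchy x ε 0<ε

_-ℝ_ : ℝ → ℝ → ℝ
x -ℝ y = x +ℝ (-ℝ y)

_*ℝ_ : ℝ → ℝ → ℝ
seq    (x *ℝ y) n = seq x n * seq y n
cauchy (x *ℝ y) ε 0<ε = proj₁ cx ℕ.⊔ proj₁ cy , λ m n N≤m N≤n →
    let dx = ∣ seq x m - seq x n ∣
        dy = ∣ seq y m - seq y n ∣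
        dx< = proj₂ cx m n (ℕ.m⊔n≤o⇒m≤o _ _ N≤m) (ℕ.m⊔n≤o⇒m≤o _ _ N≤n)
        dy< = proj₂ cy m n (ℕ.m⊔n≤o⇒n≤o _ _ N≤m) (ℕ.m⊔n≤o⇒n≤o _ _ N≤n)
    in ≤-<-trans
      (subst (λ e → ∣ e ∣ ≤ ∣ seq y m * (seq x m - seq x n) ∣ + ∣ seq x n * (seq y m - seq y n) ∣)
        (solve 4 (λ a b c d → c :* (a :- b) :+ b :* (c :- d) := (a :* c) :- (b :* d)) refl
          (seq x m) (seq x n) (seq y m) (seq y n))
        (∣p+q∣≤∣p∣+∣q∣ (seq y m * (seq x m - seq x n)) (seq x n * (seq y m - seq y n))))
      (≤-<-trans
        (+-mono-≤
          (≤-trans (≤-reflexive (∣p*q∣≡∣p∣*∣q∣ (seq y m) _)) (mulʳ (0≤∣p∣ (seq x m - seq x n)) (y≤ m)))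
          (≤-trans (≤-reflexive (∣p*q∣≡∣p∣*∣q∣ (seq x n) _)) (mulʳ (0≤∣p∣ (seq y m - seq y n)) (x≤ n))))
        (subst (By * dx + Bx * dy <_) (trans (cong₂ _+_ eqx eqy) (½*½ ε))
          (+-mono-< (*-monoʳ-<-pos By {{positive 0<By}} dx<) (*-monoʳ-<-pos Bx {{positive 0<Bx}} dy<))))
  where
  bx = bounded x
  Bx = proj₁ bx
  0<Bx = proj₁ (proj₂ bx)
  x≤ = proj₂ (proj₂ bx)
  by = bounded y
  By = proj₁ by
  0<By = proj₁ (proj₂ by)
  y≤ = proj₂ (proj₂ by)
  qx = quot By 0<By (0<½ 0<ε)
  eqx = proj₂ (proj₂ qx)
  qy = quot Bx 0<Bx (0<½ 0<ε)
  eqy = proj₂ (proj₂ qy)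
  cx = cauchy x (proj₁ qx) (proj₁ (proj₂ qx))
  cy = cauchy y (proj₁ qy) (proj₁ (proj₂ qy))

-- A nonnegative series with t (k + 1) ≤ (1 - 1 / M) * t k for all k ≥ K.
module GeometricSeries
  (t : ℕ → ℚ) (0≤t : ∀ k → 0ℚ ≤ t k) (K : ℕ) (M : ℚ) (0≤M : 0ℚ ≤ M)
  (decreasing : ∀ i → t (suc i ℕ.+ K) ≤ t (i ℕ.+ K))
  (ratio : ∀ i → M * t (suc i ℕ.+ K) + t (i ℕ.+ K) ≤ M * t (i ℕ.+ K))
  where

  mono : ∀ N j → partialSum t N ≤ partialSum t (j ℕ.+ N)
  mono N zero    = ≤-refl
  mono N (suc j) = ≤-trans (mono N j) (≤+ʳ (0≤t (j ℕ.+ N)))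

  tail : ∀ i j → partialSum t (j ℕ.+ (i ℕ.+ K)) + M * t (j ℕ.+ (i ℕ.+ K)) ≤ partialSum t (i ℕ.+ K) + M * t (i ℕ.+ K)
  tail i zero    = ≤-refl
  tail i (suc j) = ≤-trans step (tail i j)
    where
    n = j ℕ.+ (i ℕ.+ K)
    r : M * t (suc n) + t n ≤ M * t n
    r = subst (λ k → M * t (suc k) + t k ≤ M * t k) (ℕ.+-assoc j i K) (ratio (j ℕ.+ i))
    step : partialSum t n + t n + M * t (suc n) ≤ partialSum t n + M * t n
    step = subst (_≤ partialSum t n + M * t n)
      (solve 3 (λ s a b → s :+ (b :+ a) := s :+ a :+ b) refl (partialSum t n) (t n) (M * t (suc n)))
      (+-monoʳ-≤ (partialSum t n) r)

  decay : ∀ i → ι i * t (i ℕ.+ K) + M * t (i ℕ.+ K) ≤ M * t K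
  decay zero    = ≤-reflexive (trans (cong (_+ M * t K) (*-zeroˡ (t K))) (+-identityˡ (M * t K)))
  decay (suc i) = ≤-trans (≤-reflexive eq) (≤-trans
      (+-mono-≤ (mulˡ (0≤/ i 0) (decreasing i))
        (≤-trans (≤-trans (≤-reflexive (+-comm a _)) (+-monoʳ-≤ (M * a) (decreasing i))) (ratio i)))
      (decay i))
    where
    a = t (suc i ℕ.+ K)
    eq : ι (suc i) * a + M * a ≡ ι i * a + (a + M * a)
    eq = trans (cong (λ e → e * a + M * a) (ι-suc i))
      (solve 3 (λ k a m → (con 1ℚ :+ k) :* a :+ m :* a := k :* a :+ (a :+ m :* a)) refl (ι i) a M)

  M*t→0 : ∀ ε → 0ℚ < ε → ∃[ i ] M * t (i ℕ.+ K) ≤ ε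
  M*t→0 ε 0<ε = i , *-cancelˡ-≤-pos (ι i) {{positive (0<ι (proj₁ arch))}} (≤-trans
      (≤-reflexive (solve 3 (λ k m a → k :* (m :* a) := m :* (k :* a)) refl (ι i) M (t (i ℕ.+ K))))
      (≤-trans (mulˡ 0≤M (≤-trans (≤+ʳ (mul≥0 0≤M (0≤t (i ℕ.+ K)))) (decay i))) (proj₂ arch)))
    where
    arch = archimedean (M * (M * t K)) 0<ε
    i = suc (proj₁ arch)

  tails : ∀ ε → 0ℚ < ε → ∃[ N ] (∀ n → N ℕ.≤ n → partialSum t n - partialSum t N ≤ ε)
  tails ε 0<ε = N , bnd
    where
    small = M*t→0 ε 0<ε
    i = proj₁ small
    N = i ℕ.+ K
    bnd : ∀ n → N ℕ.≤ n → partialSum t n - partialSum t N ≤ ε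
    bnd n N≤n = subst (λ n → partialSum t n - partialSum t N ≤ ε) (ℕ.m∸n+n≡m N≤n)
      (≤-trans
        (+-monoˡ-≤ (- partialSum t N) (≤-trans (≤+ʳ {partialSum t (n ℕ.∸ N ℕ.+ N)} (mul≥0 0≤M (0≤t (n ℕ.∸ N ℕ.+ N)))) (tail i (n ℕ.∸ N))))
        (≤-trans (≤-reflexive (solve 2 (λ s b → s :+ b :- s := b) refl (partialSum t N) (M * t N)))
          (proj₂ small)))

  limitBound : ℚ
  limitBound = partialSum t K + M * t K

  partialSum≤limitBound : ∀ n → partialSum t n ≤ limitBound
  partialSum≤limitBound n with ℕ.≤-total n K
  ... | inj₁ n≤K = ≤-trans
    (subst (λ k → partialSum t n ≤ partialSum t k) (ℕ.m∸n+n≡m n≤K) (mono n (K ℕ.∸ n)))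
    (≤+ʳ (mul≥0 0≤M (0≤t K)))
  ... | inj₂ K≤n = subst (λ k → partialSum t k ≤ limitBound) (ℕ.m∸n+n≡m K≤n)
    (≤-trans (≤+ʳ (mul≥0 0≤M (0≤t (n ℕ.∸ K ℕ.+ K)))) (tail 0 (n ℕ.∸ K)))

  isCauchy : IsCauchy (partialSum t)
  isCauchy = cauchy-from-tails (partialSum t) λ ε 0<ε →
    let h = tails ε 0<ε
        N = proj₁ h
    in N , λ n N≤n → subst (_≤ ε)
      (sym (0≤p⇒∣p∣≡p (≤-move (subst₂ _≤_ (sym (+-identityʳ (partialSum t N)))
        (cong (partialSum t) (ℕ.m∸n+n≡m N≤n)) (mono N (n ℕ.∸ N))))))
      (proj₂ h n N≤n)

------------------------------------------------------------------------
-- The real logarithm of a positive integer, from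
--   log (m + 1) = - log (1 - m / (m + 1)) = ∑_{j ≥ 1} (m / (m + 1)) ^ j / j.

-- logTerm m j is the term of index j + 1.
logTerm : ℕ → ℕ → ℚ
logTerm m j = (+ m / suc m) ^ℚ suc j * (+ 1 / suc j)

pow≥0 : ∀ m k → 0ℚ ≤ (+ m / suc m) ^ℚ k
pow≥0 m zero    = <⇒≤ (positive⁻¹ 1ℚ)
pow≥0 m (suc k) = mul≥0 (0≤/ m m) (pow≥0 m k)

logTerm≥0 : ∀ m j → 0ℚ ≤ logTerm m j
logTerm≥0 m j = mul≥0 (pow≥0 m (suc j)) (0≤/ 1 j)

1/-suc-≤ : ∀ j → + 1 / suc (suc j) ≤ + 1 / suc j
1/-suc-≤ j = *-cancelʳ-≤-pos (ι (suc j)) {{positive (0<ι j)}} (≤-trans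
  (≤-trans (≤+ˡ (0≤/ 1 (suc j)))
    (≤-reflexive (trans (solve 2 (λ r k → r :+ r :* k := r :* (con 1ℚ :+ k)) refl (+ 1 / suc (suc j)) (ι (suc j)))
      (trans (cong ((+ 1 / suc (suc j)) *_) (sym (ι-suc (suc j)))) (/-*-cancel 1 (suc j))))))
  (≤-reflexive (sym (/-*-cancel 1 j))))

logTerm-suc : ∀ m j → logTerm m (suc j) ≤ (+ m / suc m) * logTerm m j
logTerm-suc m j = ≤-trans (≤-reflexive (*-assoc x (x ^ℚ suc j) _))
  (mulˡ (0≤/ m m) (mulˡ (pow≥0 m (suc j)) (1/-suc-≤ j)))
  where
  x = + m / suc m

logTerm-ratio : ∀ m j → ι (suc m) * logTerm m (suc j) + logTerm m j ≤ ι (suc m) * logTerm m j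
logTerm-ratio m j = ≤-trans
  (+-monoˡ-≤ a (≤-trans (mulˡ (0≤/ (suc m) 0) (logTerm-suc m j))
    (≤-reflexive (trans (solve 3 (λ k x a → k :* (x :* a) := x :* k :* a) refl (ι (suc m)) (+ m / suc m) a)
      (cong (_* a) (/-*-cancel m m))))))
  (≤-reflexive (trans (solve 2 (λ k a → k :* a :+ a := (con 1ℚ :+ k) :* a) refl (ι m) a)
    (cong (_* a) (sym (ι-suc m)))))
  where a = logTerm m j

logTerm-decreasing : ∀ m j → logTerm m (suc j) ≤ logTerm m j
logTerm-decreasing m j = *-cancelˡ-≤-pos (ι (suc m)) {{positive (0<ι m)}}
  (≤-trans (≤+ʳ (logTerm≥0 m j)) (logTerm-ratio m j))

-- The value at 0 is arbitrary and plays no role.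
log : ℕ → ℝ
log zero    = ℚ⇒ℝ 0ℚ
log (suc m) = real (partialSum (logTerm m)) isCauchy
  where
  open GeometricSeries (logTerm m) (logTerm≥0 m) 0 (ι (suc m)) (0≤/ (suc m) 0)
    (λ i → logTerm-decreasing m (i ℕ.+ 0)) (λ i → logTerm-ratio m (i ℕ.+ 0))

------------------------------------------------------------------------
-- Gaussian rationals and the partial sums of the exponential series

record ℚ[i] : Set where
  constructor _+i_
  field
    reᴳ imᴳ : ℚ

open ℚ[i] public

infixl 7 _*ᴳ_ _·ᴳ_
infixl 6 _+ᴳ_ _-ᴳ_

_+ᴳ_ _-ᴳ_ _*ᴳ_ : ℚ[i] → ℚ[i] → ℚ[i]
(a +i b) +ᴳ (c +i d) = (a + c) +i (b + d)
(a +i b) -ᴳ (c +i d) = (a - c) +i (b - d)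
(a +i b) *ᴳ (c +i d) = (a * c - b * d) +i (a * d + b * c)

_·ᴳ_ : ℚ → ℚ[i] → ℚ[i]
q ·ᴳ (a +i b) = (q * a) +i (q * b)

-- expTerm w k = w ^ k / k!.
expTerm : ℚ[i] → ℕ → ℚ[i]
expTerm w zero    = 1ℚ +i 0ℚ
expTerm w (suc k) = (+ 1 / suc k) ·ᴳ (w *ᴳ expTerm w k)

-- expSum w n = ∑_{k < n} w ^ k / k!.
expSum : ℚ[i] → ℕ → ℚ[i]
expSum w zero    = 0ℚ +i 0ℚ
expSum w (suc n) = expSum w n +ᴳ expTerm w n

module GaussianLemmas where

  ‖_‖ : ℚ[i] → ℚ
  ‖ a +i b ‖ = ∣ a ∣ + ∣ b ∣

  ‖‖≥0 : ∀ u → 0ℚ ≤ ‖ u ‖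
  ‖‖≥0 (a +i b) = add≥0 (0≤∣p∣ a) (0≤∣p∣ b)

  ‖+‖ : ∀ u v → ‖ u +ᴳ v ‖ ≤ ‖ u ‖ + ‖ v ‖
  ‖+‖ (a +i b) (c +i d) = ≤-trans (+-mono-≤ (∣p+q∣≤∣p∣+∣q∣ a c) (∣p+q∣≤∣p∣+∣q∣ b d))
    (≤-reflexive (solve 4 (λ a b c d → a :+ c :+ (b :+ d) := a :+ b :+ (c :+ d)) refl (∣ a ∣) (∣ b ∣) (∣ c ∣) (∣ d ∣)))

  ‖*‖ : ∀ u v → ‖ u *ᴳ v ‖ ≤ ‖ u ‖ * ‖ v ‖
  ‖*‖ (a +i b) (c +i d) = ≤-trans
    (+-mono-≤ (∣p-q∣≤∣p∣+∣q∣ (a * c) (b * d)) (∣p+q∣≤∣p∣+∣q∣ (a * d) (b * c)))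
    (≤-reflexive (trans
      (cong₂ _+_ (cong₂ _+_ (∣p*q∣≡∣p∣*∣q∣ a c) (∣p*q∣≡∣p∣*∣q∣ b d))
                 (cong₂ _+_ (∣p*q∣≡∣p∣*∣q∣ a d) (∣p*q∣≡∣p∣*∣q∣ b c)))
      (solve 4 (λ a b c d → a :* c :+ b :* d :+ (a :* d :+ b :* c) := (a :+ b) :* (c :+ d)) refl
        (∣ a ∣) (∣ b ∣) (∣ c ∣) (∣ d ∣))))

  ‖·‖ : ∀ {q} → 0ℚ ≤ q → ∀ u → ‖ q ·ᴳ u ‖ ≡ q * ‖ u ‖
  ‖·‖ {q} 0≤q (a +i b) = trans
    (cong₂ _+_ (trans (∣p*q∣≡∣p∣*∣q∣ q a) (cong (_* ∣ a ∣) (0≤p⇒∣p∣≡p 0≤q)))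
               (trans (∣p*q∣≡∣p∣*∣q∣ q b) (cong (_* ∣ b ∣) (0≤p⇒∣p∣≡p 0≤q))))
    (sym (*-distribˡ-+ q ∣ a ∣ ∣ b ∣))

  dist : ℚ[i] → ℚ[i] → ℚ
  dist u v = ‖ u -ᴳ v ‖

  dist-refl : ∀ u → dist u u ≡ 0ℚ
  dist-refl (a +i b) = trans (cong₂ (λ p q → ∣ p ∣ + ∣ q ∣) (+-inverseʳ a) (+-inverseʳ b)) (+-identityʳ 0ℚ)

  dist-triangle : ∀ u v w → dist u w ≤ dist u v + dist v w
  dist-triangle u@(a +i b) v@(c +i d) w@(e +i f) = subst (λ x → ‖ x ‖ ≤ dist u v + dist v w)
    (cong₂ _+i_ (lem a c e) (lem b d f)) (‖+‖ (u -ᴳ v) (v -ᴳ w))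
    where
    lem : ∀ p q r → (p - q) + (q - r) ≡ p - r
    lem = solve 3 (λ p q r → (p :- q) :+ (q :- r) := p :- r) refl

  dist-+ : ∀ u v x y → dist (u +ᴳ x) (v +ᴳ y) ≤ dist u v + dist x y
  dist-+ u@(a +i b) v@(c +i d) x@(e +i f) y@(g +i h) = subst (λ z → ‖ z ‖ ≤ dist u v + dist x y)
    (cong₂ _+i_ (lem a c e g) (lem b d f h)) (‖+‖ (u -ᴳ v) (x -ᴳ y))
    where
    lem : ∀ p q r s → (p - q) + (r - s) ≡ (p + r) - (q + s)
    lem = solve 4 (λ p q r s → (p :- q) :+ (r :- s) := (p :+ r) :- (q :+ s)) refl

  dist-step : ∀ u v x → dist (u +ᴳ x) v ≤ dist u v + ‖ x ‖
  dist-step u@(a +i b) v@(c +i d) x@(e +i f) = subst (λ z → ‖ z ‖ ≤ dist u v + ‖ x ‖)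
    (cong₂ _+i_ (lem a c e) (lem b d f)) (‖+‖ (u -ᴳ v) x)
    where
    lem : ∀ p q r → (p - q) + r ≡ (p + r) - q
    lem = solve 3 (λ p q r → (p :- q) :+ r := (p :+ r) :- q) refl

  dist-* : ∀ u v x y → dist (u *ᴳ x) (v *ᴳ y) ≤ dist u v * ‖ x ‖ + ‖ v ‖ * dist x y
  dist-* u@(a +i b) v@(c +i d) x@(e +i f) y@(g +i h) = subst (λ z → ‖ z ‖ ≤ dist u v * ‖ x ‖ + ‖ v ‖ * dist x y)
    (cong₂ _+i_
      (solve 8 (λ a b c d e f g h →
          ((a :- c) :* e :- (b :- d) :* f) :+ (c :* (e :- g) :- d :* (f :- h))
            := (a :* e :- b :* f) :- (c :* g :- d :* h)) refl a b c d e f g h)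
      (solve 8 (λ a b c d e f g h →
          ((a :- c) :* f :+ (b :- d) :* e) :+ (c :* (f :- h) :+ d :* (e :- g))
            := (a :* f :+ b :* e) :- (c :* h :+ d :* g)) refl a b c d e f g h))
    (≤-trans (‖+‖ ((u -ᴳ v) *ᴳ x) (v *ᴳ (x -ᴳ y))) (+-mono-≤ (‖*‖ (u -ᴳ v) x) (‖*‖ v (x -ᴳ y))))

  dist-· : ∀ {q} → 0ℚ ≤ q → ∀ u v → dist (q ·ᴳ u) (q ·ᴳ v) ≡ q * dist u v
  dist-· {q} 0≤q u@(a +i b) v@(c +i d) = trans
    (cong ‖_‖ (cong₂ _+i_ (lem q a c) (lem q b d))) (‖·‖ 0≤q (u -ᴳ v))
    where
    lem : ∀ q a c → q * a - q * c ≡ q * (a - c)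
    lem = solve 3 (λ q a c → q :* a :- q :* c := q :* (a :- c)) refl

module ExpLemmas (B : ℚ) (0≤B : 0ℚ ≤ B) where
  open GaussianLemmas

  term : ℕ → ℚ
  term zero    = 1ℚ
  term (suc k) = (+ 1 / suc k) * (B * term k)

  term≥0 : ∀ k → 0ℚ ≤ term k
  term≥0 zero    = <⇒≤ (positive⁻¹ 1ℚ)
  term≥0 (suc k) = mul≥0 (0≤/ 1 k) (mul≥0 0≤B (term≥0 k))

  2ℚ : ℚ
  2ℚ = 1ℚ + 1ℚ

  K : ℕ
  K = proj₁ (p≤ι (2ℚ * B))

  ι-mono : ∀ i k → ι (suc k) ≤ ι (suc (i ℕ.+ k))
  ι-mono zero    k = ≤-refl
  ι-mono (suc i) k = ≤-trans (ι-mono i k)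
    (≤-trans (≤+ˡ (<⇒≤ (positive⁻¹ 1ℚ))) (≤-reflexive (sym (ι-suc (suc (i ℕ.+ k))))))

  2*term-suc≤term : ∀ i → 2ℚ * term (suc i ℕ.+ K) ≤ term (i ℕ.+ K)
  2*term-suc≤term i = ≤-trans
    (≤-reflexive (solve 4 (λ m r b t → m :* (r :* (b :* t)) := r :* (m :* b) :* t) refl 2ℚ r B (term k)))
    (≤-trans (mulʳ (term≥0 k) (≤-trans
        (mulˡ (0≤/ 1 k) (≤-trans (proj₂ (p≤ι (2ℚ * B))) (ι-mono i K)))
        (≤-reflexive (/-*-cancel 1 k))))
      (≤-reflexive (*-identityˡ (term k))))
    where
    k = i ℕ.+ K
    r = + 1 / suc k

  2*≡+ : ∀ a → 2ℚ * a ≡ a + a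
  2*≡+ = solve 1 (λ a → (con 1ℚ :+ con 1ℚ) :* a := a :+ a) refl

  open GeometricSeries term term≥0 K 2ℚ (<⇒≤ (positive⁻¹ 2ℚ))
    (λ i → ≤-trans (≤-trans (≤+ʳ (term≥0 (suc i ℕ.+ K))) (≤-reflexive (sym (2*≡+ (term (suc i ℕ.+ K)))))) (2*term-suc≤term i))
    (λ i → ≤-trans (+-monoˡ-≤ (term (i ℕ.+ K)) (2*term-suc≤term i)) (≤-reflexive (sym (2*≡+ (term (i ℕ.+ K))))))
    public using (limitBound; partialSum≤limitBound; tails; mono)

  ‖expTerm‖≤ : ∀ w → ‖ w ‖ ≤ B → ∀ k → ‖ expTerm w k ‖ ≤ term k
  ‖expTerm‖≤ w w≤B zero    = ≤-refl
  ‖expTerm‖≤ w w≤B (suc k) = ≤-trans (≤-reflexive (‖·‖ (0≤/ 1 k) (w *ᴳ expTerm w k)))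
    (mulˡ (0≤/ 1 k) (≤-trans (‖*‖ w (expTerm w k))
      (≤-trans (mulʳ (‖‖≥0 (expTerm w k)) w≤B) (mulˡ 0≤B (‖expTerm‖≤ w w≤B k)))))

  expSum-tail : ∀ w → ‖ w ‖ ≤ B → ∀ N j → dist (expSum w (j ℕ.+ N)) (expSum w N) ≤ partialSum term (j ℕ.+ N) - partialSum term N
  expSum-tail w w≤B N zero    = ≤-reflexive (trans (dist-refl (expSum w N)) (sym (+-inverseʳ (partialSum term N))))
  expSum-tail w w≤B N (suc j) = ≤-trans (dist-step (expSum w n) (expSum w N) (expTerm w n))
    (≤-trans (+-mono-≤ (expSum-tail w w≤B N j) (‖expTerm‖≤ w w≤B n))
      (≤-reflexive (solve 3 (λ s r t → s :- r :+ t := s :+ t :- r) refl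
        (partialSum term n) (partialSum term N) (term n))))
    where n = j ℕ.+ N

  expTerm-lipschitz : ∀ u v → ‖ u ‖ ≤ B → ‖ v ‖ ≤ B → ∀ k →
    dist (expTerm u (suc k)) (expTerm v (suc k)) ≤ dist u v * term k
  expTerm-lipschitz-step : ∀ u v → ‖ u ‖ ≤ B → ‖ v ‖ ≤ B → ∀ k {e} →
    dist (expTerm u k) (expTerm v k) ≤ e →
    dist (expTerm u (suc k)) (expTerm v (suc k)) ≤ (+ 1 / suc k) * (dist u v * term k + B * e)
  expTerm-lipschitz-step u v u≤B v≤B k h = ≤-trans
    (≤-reflexive (dist-· (0≤/ 1 k) (u *ᴳ expTerm u k) (v *ᴳ expTerm v k)))
    (mulˡ (0≤/ 1 k) (≤-trans (dist-* u v (expTerm u k) (expTerm v k))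
      (+-mono-≤ (mulˡ (‖‖≥0 (u -ᴳ v)) (‖expTerm‖≤ u u≤B k))
        (≤-trans (mulʳ (‖‖≥0 (expTerm u k -ᴳ expTerm v k)) v≤B) (mulˡ 0≤B h)))))
  expTerm-lipschitz u v u≤B v≤B zero = ≤-trans
    (expTerm-lipschitz-step u v u≤B v≤B 0 (≤-reflexive (dist-refl (1ℚ +i 0ℚ))))
    (≤-reflexive (solve 2 (λ d b → con 1ℚ :* (d :* con 1ℚ :+ b :* con 0ℚ) := d :* con 1ℚ) refl (dist u v) B))
  expTerm-lipschitz u v u≤B v≤B (suc k) = ≤-trans
    (expTerm-lipschitz-step u v u≤B v≤B (suc k) (expTerm-lipschitz u v u≤B v≤B k))
    (≤-reflexive (trans (cong (r' *_) eq₁) eq₂))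
    where
    r  = + 1 / suc k
    r' = + 1 / suc (suc k)
    d  = dist u v
    b  = B * term k
    eq₁ : d * (r * b) + B * (d * term k) ≡ d * (r * b) * ι (suc (suc k))
    eq₁ = trans
      (cong (λ e → d * (r * b) + e) (trans
        (solve 3 (λ b d t → b :* (d :* t) := d :* (con 1ℚ :* (b :* t))) refl B d (term k))
        (cong (λ e → d * (e * b)) (sym (/-*-cancel 1 k)))))
      (trans (solve 4 (λ d r b k → d :* (r :* b) :+ d :* (r :* k :* b) := d :* (r :* b) :* (con 1ℚ :+ k)) refl d r b (ι (suc k)))
        (cong (λ e → d * (r * b) * e) (sym (ι-suc (suc k)))))
    eq₂ : r' * (d * (r * b) * ι (suc (suc k))) ≡ d * (r * b)
    eq₂ = trans (solve 3 (λ r x k → r :* (x :* k) := r :* k :* x) refl r' (d * (r * b)) (ι (suc (suc k))))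
      (trans (cong (_* (d * (r * b))) (/-*-cancel 1 (suc k))) (*-identityˡ (d * (r * b))))

  expSum-lipschitz : ∀ u v → ‖ u ‖ ≤ B → ‖ v ‖ ≤ B → ∀ n →
    dist (expSum u (suc n)) (expSum v (suc n)) ≤ dist u v * partialSum term n
  expSum-lipschitz u v u≤B v≤B zero    = ≤-reflexive (sym (*-zeroʳ (dist u v)))
  expSum-lipschitz u v u≤B v≤B (suc n) = ≤-trans
    (dist-+ (expSum u (suc n)) (expSum v (suc n)) (expTerm u (suc n)) (expTerm v (suc n)))
    (≤-trans (+-mono-≤ (expSum-lipschitz u v u≤B v≤B n) (expTerm-lipschitz u v u≤B v≤B n))
      (≤-reflexive (sym (*-distribˡ-+ (dist u v) (partialSum term n) (term n)))))

  limitBound≥0 : 0ℚ ≤ limitBound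
  limitBound≥0 = partialSum≤limitBound 0

  expSum-lipschitz′ : ∀ u v → ‖ u ‖ ≤ B → ‖ v ‖ ≤ B → ∀ n →
    dist (expSum u n) (expSum v n) ≤ dist u v * (limitBound + 1ℚ)
  expSum-lipschitz′ u v u≤B v≤B zero    = mul≥0 (‖‖≥0 (u -ᴳ v)) (add≥0 limitBound≥0 (<⇒≤ (positive⁻¹ 1ℚ)))
  expSum-lipschitz′ u v u≤B v≤B (suc n) = ≤-trans (expSum-lipschitz u v u≤B v≤B n)
    (mulˡ (‖‖≥0 (u -ᴳ v)) (≤-trans (partialSum≤limitBound n) (≤+ʳ (<⇒≤ (positive⁻¹ 1ℚ)))))

------------------------------------------------------------------------
-- Complex numbers

record ℂ : Set where
  constructor complex
  field
    re im : ℝ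

open ℂ public

infix 4 _≈ℂ_

_≈ℂ_ : ℂ → ℂ → Set
w ≈ℂ z = re w ≈ℝ re z × im w ≈ℝ im z

ℝ⇒ℂ : ℝ → ℂ
ℝ⇒ℂ x = complex x (ℚ⇒ℝ 0ℚ)

0ℂ 1ℂ : ℂ
0ℂ = ℝ⇒ℂ (ℚ⇒ℝ 0ℚ)
1ℂ = ℝ⇒ℂ (ℚ⇒ℝ 1ℚ)

infix  8 -ℂ_
infixl 7 _*ℂ_
infixl 6 _+ℂ_

_+ℂ_ : ℂ → ℂ → ℂ
w +ℂ z = complex (re w +ℝ re z) (im w +ℝ im z)

-ℂ_ : ℂ → ℂ
-ℂ z = complex (-ℝ re z) (-ℝ im z)

_*ℂ_ : ℂ → ℂ → ℂ
w *ℂ z = complex (re w *ℝ re z -ℝ im w *ℝ im z) (re w *ℝ im z +ℝ im w *ℝ re z)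

ℂ-rawRing : RawRing 0ℓ 0ℓ
ℂ-rawRing = record
  { Carrier = ℂ ; _≈_ = _≈ℂ_ ; _+_ = _+ℂ_ ; _*_ = _*ℂ_ ; -_ = -ℂ_ ; 0# = 0ℂ ; 1# = 1ℂ }

open RawSemiringDefs (RawRing.rawSemiring ℂ-rawRing) public using () renaming (_^_ to _^ℂ_)

approx : ℂ → ℕ → ℚ[i]
approx z n = seq (re z) n +i seq (im z) n

expSum-tails : ∀ z ε → 0ℚ < ε → let open GaussianLemmas in
  ∃[ N ] (∀ n → N ℕ.≤ n → dist (expSum (approx z n) n) (expSum (approx z N) N) ≤ ε)
expSum-tails z ε 0<ε = N , bnd
  where
  open GaussianLemmas
  bx = bounded (re z)
  by = bounded (im z)
  B = proj₁ bx + proj₁ by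
  open ExpLemmas B (add≥0 (<⇒≤ (proj₁ (proj₂ bx))) (<⇒≤ (proj₁ (proj₂ by))))
  E : ℕ → ℚ[i]
  E n = expSum (approx z n) n
  z≤B : ∀ n → ‖ approx z n ‖ ≤ B
  z≤B n = +-mono-≤ (proj₂ (proj₂ bx) n) (proj₂ (proj₂ by) n)
  C = limitBound + 1ℚ
  0<C : 0ℚ < C
  0<C = <-≤-trans (positive⁻¹ 1ℚ) (≤+ˡ {1ℚ} {limitBound} limitBound≥0)
  ε/2 = ½ * ε
  ε/4 = ½ * ε/2
  q = quot C 0<C (0<½ (0<½ 0<ε))
  δ = proj₁ q
  cx = cauchy (re z) δ (proj₁ (proj₂ q))
  cy = cauchy (im z) δ (proj₁ (proj₂ q))
  ts = tails ε/4 (0<½ (0<½ 0<ε))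
  N₁ Nx Ny N : ℕ
  N₁ = proj₁ ts
  Nx = proj₁ cx
  Ny = proj₁ cy
  N = N₁ ℕ.⊔ (Nx ℕ.⊔ Ny)
  N₁≤N : N₁ ℕ.≤ N
  N₁≤N = ℕ.m≤m⊔n N₁ (Nx ℕ.⊔ Ny)
  Nx≤N : Nx ℕ.≤ N
  Nx≤N = ℕ.≤-trans (ℕ.m≤m⊔n Nx Ny) (ℕ.m≤n⊔m N₁ (Nx ℕ.⊔ Ny))
  Ny≤N : Ny ℕ.≤ N
  Ny≤N = ℕ.≤-trans (ℕ.m≤n⊔m Nx Ny) (ℕ.m≤n⊔m N₁ (Nx ℕ.⊔ Ny))
  bnd : ∀ n → N ℕ.≤ n → dist (E n) (E N) ≤ ε
  bnd n N≤n = ≤-trans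
    (dist-triangle (E n) (expSum (approx z n) N) (E N))
    (≤-trans (+-mono-≤ part₁ part₂) (≤-reflexive (½*½ ε)))
    where
    S₁≤S : partialSum term N₁ ≤ partialSum term N
    S₁≤S = subst (λ k → partialSum term N₁ ≤ partialSum term k) (ℕ.m∸n+n≡m N₁≤N) (mono N₁ (N ℕ.∸ N₁))
    part₁ : dist (E n) (expSum (approx z n) N) ≤ ε/2
    part₁ = ≤-trans
      (subst (λ k → dist (expSum (approx z n) k) (expSum (approx z n) N) ≤ partialSum term k - partialSum term N)
        (ℕ.m∸n+n≡m N≤n) (expSum-tail (approx z n) (z≤B n) N (n ℕ.∸ N)))
      (≤-trans (+-monoʳ-≤ (partialSum term n) (neg-antimono-≤ S₁≤S))
        (≤-trans (proj₂ ts n (ℕ.≤-trans N₁≤N N≤n)) (<⇒≤ (½< (0<½ 0<ε)))))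
    part₂ : dist (expSum (approx z n) N) (E N) ≤ ε/2
    part₂ = ≤-trans (expSum-lipschitz′ (approx z n) (approx z N) (z≤B n) (z≤B N) N)
      (≤-trans (mulʳ (<⇒≤ 0<C) (+-mono-≤
          (<⇒≤ (proj₂ cx n N (ℕ.≤-trans Nx≤N N≤n) Nx≤N))
          (<⇒≤ (proj₂ cy n N (ℕ.≤-trans Ny≤N N≤n) Ny≤N))))
        (≤-reflexive (trans (solve 2 (λ d c → (d :+ d) :* c := c :* d :+ c :* d) refl δ C)
          (trans (cong₂ _+_ (proj₂ (proj₂ q)) (proj₂ (proj₂ q))) (½*½ ε/2)))))

-- exp z is the limit of ∑_{k < n} (approx z n) ^ k / k!.
exp : ℂ → ℂ
exp z = complex
  (real reSeq (cauchy-from-tails reSeq λ ε 0<ε → let (N , h) = expSum-tails z ε 0<ε in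
    N , λ n N≤n → ≤-trans (≤+ʳ {∣ reSeq n - reSeq N ∣} (0≤∣p∣ (imSeq n - imSeq N))) (h n N≤n)))
  (real imSeq (cauchy-from-tails imSeq λ ε 0<ε → let (N , h) = expSum-tails z ε 0<ε in
    N , λ n N≤n → ≤-trans (≤+ˡ {∣ imSeq n - imSeq N ∣} (0≤∣p∣ (reSeq n - reSeq N))) (h n N≤n)))
  where
  reSeq imSeq : ℕ → ℚ
  reSeq n = reᴳ (expSum (approx z n) n)
  imSeq n = imᴳ (expSum (approx z n) n)

-- m ^ᶜ z = e ^ (z log m) for a positive integer m.
infixr 8 _^ᶜ_

_^ᶜ_ : ℕ → ℂ → ℂ
m ^ᶜ z = exp (z *ℂ ℝ⇒ℂ (log m))

------------------------------------------------------------------------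
-- Finite sums

∑ : ∀ {A : Set} → List A → (A → ℂ) → ℂ
∑ xs f = foldr (λ x acc → f x +ℂ acc) 0ℂ xs

infix 5 ∑-syntax

∑-syntax : ∀ {A : Set} → List A → (A → ℂ) → ℂ
∑-syntax = ∑

syntax ∑-syntax xs (λ x → e) = ∑[ x ∈ xs ] e

[1⋯_] : ℕ → List ℕ
[1⋯ n ] = applyUpTo suc n

------------------------------------------------------------------------
-- Partitions into distinct parts, as strictly decreasing lists

record IsDistinctPartition (n : ℕ) (π : List ℕ) : Set where
  field
    positive-parts : All (1 ℕ.≤_) π
    decreasing     : AllPairs ℕ._>_ π
    total          : sum π ≡ n

subsequences : ∀ {A : Set} → List A → List (List A)
subsequences []       = [] ∷ []
subsequences (x ∷ xs) = map (x ∷_) (subsequences xs) ++ subsequences xs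

-- A partition of n into distinct parts is a subset of {1, …, n} with sum n.
-- 𝒟-Lemmas shows that the list enumerates them exactly, without repetition.
𝒟 : ℕ → List (List ℕ)
𝒟 n = filter (λ π → sum π ℕ.≟ n) (subsequences (applyDownFrom suc n))

module 𝒟-Lemmas where

  Bounded : ℕ → List ℕ → Set
  Bounded k π = All (λ p → 1 ℕ.≤ p × p ℕ.≤ k) π

  subsequence⁻ : ∀ k {π} → π ∈ subsequences (applyDownFrom suc k) → AllPairs ℕ._>_ π × Bounded k π
  subsequence⁻ zero    (here refl) = [] , []
  subsequence⁻ (suc k) π∈ with ∈-++⁻ (map (suc k ∷_) (subsequences (applyDownFrom suc k))) π∈
  ... | inj₁ π∈ˡ with ∈-map⁻ (suc k ∷_) π∈ˡ
  ...   | _ , ρ∈ , refl with subsequence⁻ k ρ∈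
  ...     | dec , bnd = All.map (λ b → ℕ.s≤s (proj₂ b)) bnd ∷ dec
                      , (ℕ.s≤s ℕ.z≤n , ℕ.≤-refl) ∷ All.map (λ b → proj₁ b , ℕ.m≤n⇒m≤1+n (proj₂ b)) bnd
  subsequence⁻ (suc k) π∈ | inj₂ π∈ʳ with subsequence⁻ k π∈ʳ
  ... | dec , bnd = dec , All.map (λ b → proj₁ b , ℕ.m≤n⇒m≤1+n (proj₂ b)) bnd

  below : ∀ {x π} k → x ℕ.≤ suc k → All (x ℕ.>_) π → All (1 ℕ.≤_) π → Bounded k π
  below k x≤ x>π 1≤π = All.zipWith
    (λ (x>p , 1≤p) → 1≤p , ℕ.s≤s⁻¹ (ℕ.≤-trans x>p x≤)) (x>π , 1≤π)

  subsequence⁺ : ∀ k {π} → AllPairs ℕ._>_ π → Bounded k π → π ∈ subsequences (applyDownFrom suc k)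
  subsequence⁺ zero    []        []                    = here refl
  subsequence⁺ zero    _         ((ℕ.s≤s _ , ()) ∷ _)
  subsequence⁺ (suc k) []        []                    = ∈-++⁺ʳ (map (suc k ∷_) _) (subsequence⁺ k [] [])
  subsequence⁺ (suc k) (x>π ∷ dec) ((1≤x , x≤) ∷ bnd) with ℕ.m≤n⇒m<n∨m≡n x≤
  ... | inj₂ refl = ∈-++⁺ˡ (∈-map⁺ (suc k ∷_) (subsequence⁺ k dec (below k x≤ x>π (All.map proj₁ bnd))))
  ... | inj₁ x<   = ∈-++⁺ʳ (map (suc k ∷_) _) (subsequence⁺ k (x>π ∷ dec)
    ((1≤x , ℕ.s≤s⁻¹ x<) ∷ below k x≤ x>π (All.map proj₁ bnd)))

  parts≤sum : ∀ π → All (ℕ._≤ sum π) π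
  parts≤sum []      = []
  parts≤sum (x ∷ π) = ℕ.m≤m+n x (sum π) ∷ All.map (λ p≤ → ℕ.≤-trans p≤ (ℕ.m≤n+m (sum π) x)) (parts≤sum π)

  ∈𝒟⇔ : ∀ n π → π ∈ 𝒟 n ⇔ IsDistinctPartition n π
  ∈𝒟⇔ n π = mk⇔ to from
    where
    to : π ∈ 𝒟 n → IsDistinctPartition n π
    to π∈ with ∈-filter⁻ (λ π → sum π ℕ.≟ n) {xs = subsequences (applyDownFrom suc n)} π∈
    ... | π∈s , eq = record
      { positive-parts = All.map proj₁ (proj₂ (subsequence⁻ n π∈s))
      ; decreasing     = proj₁ (subsequence⁻ n π∈s)
      ; total          = eq
      }
    from : IsDistinctPartition n π → π ∈ 𝒟 n
    from record { positive-parts = pos ; decreasing = dec ; total = refl } =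
      ∈-filter⁺ (λ π → sum π ℕ.≟ n) (subsequence⁺ n dec (All.zip (pos , parts≤sum π))) refl

  subsequences-unique : ∀ k → Unique (subsequences (applyDownFrom suc k))
  subsequences-unique zero    = [] ∷ []
  subsequences-unique (suc k) = Unique.++⁺
    (Unique.map⁺ List.∷-injectiveʳ (subsequences-unique k)) (subsequences-unique k) disjoint
    where
    disjoint : ∀ {π} → ¬ (π ∈ map (suc k ∷_) (subsequences (applyDownFrom suc k)) × π ∈ subsequences (applyDownFrom suc k))
    disjoint (∈ˡ , ∈ʳ) with ∈-map⁻ (suc k ∷_) ∈ˡ
    ... | _ , _ , refl with proj₂ (subsequence⁻ k ∈ʳ)
    ...   | (_ , 1+k≤k) ∷ _ = contradiction 1+k≤k ℕ.1+n≰n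

  𝒟-unique : ∀ n → Unique (𝒟 n)
  𝒟-unique n = Unique.filter⁺ (λ π → sum π ℕ.≟ n) (subsequences-unique n)

infix 9 #_

#_ : List ℕ → ℕ
# π = length π

-- The values at the empty list are arbitrary: partitions of n ≥ 1 are nonempty.
s ℓ : List ℕ → ℕ
s []      = 0
s (p ∷ π) = min p π
ℓ π       = max 0 π

------------------------------------------------------------------------
-- The divisor sum

divisors : ℕ → List ℕ
divisors n = filter (_∣? n) [1⋯ n ]

σ : ℂ → ℂ → ℕ → ℂ
σ z c n = ∑[ d ∈ divisors n ] (d ^ᶜ z *ℂ c ^ℂ d)

{-# OPTIONS --safe #-}

-- Both sides are linear in the values f m = m ^ᶜ z * c ^ m, so the claim reduces,
-- componentwise in the approximating sequences, to an identity for an arbitrary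
-- f : ℕ → ℚ. Comparing coefficients of f m,
-- one has to sum (-1) ^ (# π - 1) over the π ∈ 𝒟 n with ℓ π - s π < m ≤ ℓ π. With
-- L = ℓ π = r + m this has the generating function
--     ∑_{r ≥ 0} q^(r + m) (1 - q^(r + 1)) ⋯ (1 - q^(r + m - 1)),
-- and (1 - q^m) times the r-th term is q^m (P_r - P_{r-1}), where
-- P_r = (1 - q^(r + 1)) ⋯ (1 - q^(r + m)) and P_{-1} = 0. Since P_r → 1, the sum
-- telescopes to q^m / (1 - q^m).
module Submission where

open import Data.Nat.Base using (ℕ; NonZero; _∸_; _+_)
open import Defs

open import Data.Bool.Base using (if_then_else_)
open import Data.List.Base using (List; []; _∷_; _++_; map; filter; applyUpTo; applyDownFrom)
open import Data.List.Extrema.Nat using (min≤⊤; min≤xs; v<min⁺; max≤v⁺; v≤max⁺)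
open import Data.List.Membership.Propositional using (_∈_)
open import Data.List.Relation.Unary.All as All using (All; []; _∷_; all?)
open import Data.List.Relation.Unary.Any using (here; there)
open import Data.Nat.Base as ℕ using (zero; suc; s≤s; z≤n; s≤s⁻¹)
open import Data.Nat.Divisibility using (_∣_; _∣?_; _∣0; ∣m+n∣m⇒∣n; ∣m∣n⇒∣m+n; ∣-refl; >⇒∤)
open import Data.Nat.Induction using (<-rec)
open import Data.Nat.ListAction using (sum)
import Data.Nat.Properties as ℕ
open import Data.Product.Base using (_×_; _,_; proj₁; proj₂)
open import Data.Rational.Base as ℚ using (ℚ; 0ℚ; 1ℚ; _-_; -_)
  renaming (_+_ to _+ℚ_; _*_ to _*ℚ_)
import Data.Rational.Properties as ℚ
open import Data.Rational.Solver using (module +-*-Solver)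
open import Data.Sum.Base using (inj₁; inj₂)
open import Function.Base using (_∘_)
open import Function.Bundles using (mk⇔)
open import Relation.Binary.PropositionalEquality
open import Relation.Nullary.Decidable using (Dec; does; yes; no; dec-true; dec-false; does-⇔)
open import Relation.Nullary.Negation using (¬_; contradiction)

open RationalLemmas using (partialSum)
open +-*-Solver using (solve; _:+_; _:*_; _:-_; :-_; _:=_; con)
open ≡-Reasoning

private variable
  A B P Q : Set

-- Indicators of decidable propositions

χ : Dec P → ℚ
χ d = if does d then 1ℚ else 0ℚ

χ-true : (d : Dec P) → P → χ d ≡ 1ℚ
χ-true d p = cong (if_then 1ℚ else 0ℚ) (dec-true d p)

χ-false : (d : Dec P) → ¬ P → χ d ≡ 0ℚ
χ-false d ¬p = cong (if_then 1ℚ else 0ℚ) (dec-false d ¬p)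

χ-cong : (d : Dec P) (e : Dec Q) → (P → Q) → (Q → P) → χ d ≡ χ e
χ-cong d e f g = cong (if_then 1ℚ else 0ℚ) (does-⇔ (mk⇔ f g) d e)

-- Finite sums of rationals

∑ℚ : List A → (A → ℚ) → ℚ
∑ℚ []       f = 0ℚ
∑ℚ (x ∷ xs) f = f x +ℚ ∑ℚ xs f

∑ℚ-cong : ∀ (xs : List A) {f g} → (∀ {x} → x ∈ xs → f x ≡ g x) → ∑ℚ xs f ≡ ∑ℚ xs g
∑ℚ-cong []       h = refl
∑ℚ-cong (x ∷ xs) h = cong₂ _+ℚ_ (h (here refl)) (∑ℚ-cong xs (h ∘ there))

∑ℚ-zero : ∀ (xs : List A) {f} → (∀ {x} → x ∈ xs → f x ≡ 0ℚ) → ∑ℚ xs f ≡ 0ℚ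
∑ℚ-zero []       h = refl
∑ℚ-zero (x ∷ xs) h = cong₂ _+ℚ_ (h (here refl)) (∑ℚ-zero xs (h ∘ there))

∑ℚ-+ : ∀ (xs : List A) f g → ∑ℚ xs (λ x → f x +ℚ g x) ≡ ∑ℚ xs f +ℚ ∑ℚ xs g
∑ℚ-+ []       f g = refl
∑ℚ-+ (x ∷ xs) f g = trans (cong (f x +ℚ g x +ℚ_) (∑ℚ-+ xs f g))
  (solve 4 (λ a b c d → (a :+ b) :+ (c :+ d) := (a :+ c) :+ (b :+ d)) refl
    (f x) (g x) (∑ℚ xs f) (∑ℚ xs g))

∑ℚ-*ˡ : ∀ (xs : List A) c f → ∑ℚ xs (λ x → c *ℚ f x) ≡ c *ℚ ∑ℚ xs f
∑ℚ-*ˡ []       c f = sym (ℚ.*-zeroʳ c)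
∑ℚ-*ˡ (x ∷ xs) c f = trans (cong (c *ℚ f x +ℚ_) (∑ℚ-*ˡ xs c f)) (sym (ℚ.*-distribˡ-+ c (f x) (∑ℚ xs f)))

∑ℚ-++ : ∀ (xs ys : List A) f → ∑ℚ (xs ++ ys) f ≡ ∑ℚ xs f +ℚ ∑ℚ ys f
∑ℚ-++ []       ys f = sym (ℚ.+-identityˡ _)
∑ℚ-++ (x ∷ xs) ys f = trans (cong (f x +ℚ_) (∑ℚ-++ xs ys f)) (sym (ℚ.+-assoc (f x) (∑ℚ xs f) (∑ℚ ys f)))

∑ℚ-map : ∀ (h : A → B) xs f → ∑ℚ (map h xs) f ≡ ∑ℚ xs (f ∘ h)
∑ℚ-map h []       f = refl
∑ℚ-map h (x ∷ xs) f = cong (f (h x) +ℚ_) (∑ℚ-map h xs f)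

∑ℚ-filter : ∀ {R : A → Set} (R? : ∀ x → Dec (R x)) xs f →
  ∑ℚ (filter R? xs) f ≡ ∑ℚ xs (λ x → χ (R? x) *ℚ f x)
∑ℚ-filter R? []       f = refl
∑ℚ-filter R? (x ∷ xs) f with R? x
... | yes _ = cong₂ _+ℚ_ (sym (ℚ.*-identityˡ (f x))) (∑ℚ-filter R? xs f)
... | no  _ = trans (∑ℚ-filter R? xs f)
  (trans (sym (ℚ.+-identityˡ _)) (cong (_+ℚ _) (sym (ℚ.*-zeroˡ (f x)))))

partialSum-cong : ∀ n {f g} → (∀ {i} → i ℕ.< n → f i ≡ g i) → partialSum f n ≡ partialSum g n
partialSum-cong zero    h = refl
partialSum-cong (suc n) h = cong₂ _+ℚ_ (partialSum-cong n (h ∘ ℕ.m≤n⇒m≤1+n)) (h ℕ.≤-refl)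

partialSum-zero : ∀ n {f} → (∀ {i} → i ℕ.< n → f i ≡ 0ℚ) → partialSum f n ≡ 0ℚ
partialSum-zero zero    h = refl
partialSum-zero (suc n) h = cong₂ _+ℚ_ (partialSum-zero n (h ∘ ℕ.m≤n⇒m≤1+n)) (h ℕ.≤-refl)

partialSum-++ : ∀ f a b → partialSum f (a + b) ≡ partialSum f a +ℚ partialSum (f ∘ (a +_)) b
partialSum-++ f a zero    = trans (cong (partialSum f) (ℕ.+-identityʳ a)) (sym (ℚ.+-identityʳ _))
partialSum-++ f a (suc b) = begin
  partialSum f (a + suc b)                                    ≡⟨ cong (partialSum f) (ℕ.+-suc a b) ⟩
  partialSum f (a + b) +ℚ f (a + b)                           ≡⟨ cong (_+ℚ f (a + b)) (partialSum-++ f a b) ⟩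
  partialSum f a +ℚ partialSum (f ∘ (a +_)) b +ℚ f (a + b)    ≡⟨ ℚ.+-assoc (partialSum f a) _ _ ⟩
  partialSum f a +ℚ partialSum (f ∘ (a +_)) (suc b)           ∎

partialSum-*ʳ : ∀ n f c → partialSum (λ i → f i *ℚ c) n ≡ partialSum f n *ℚ c
partialSum-*ʳ zero    f c = sym (ℚ.*-zeroˡ c)
partialSum-*ʳ (suc n) f c = trans (cong (_+ℚ f n *ℚ c) (partialSum-*ʳ n f c)) (sym (ℚ.*-distribʳ-+ c (partialSum f n) (f n)))

∑ℚ-applyUpTo : ∀ (h : ℕ → A) f n → ∑ℚ (applyUpTo h n) f ≡ partialSum (f ∘ h) n
∑ℚ-applyUpTo h f zero    = refl
∑ℚ-applyUpTo h f (suc n) = begin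
  f (h 0) +ℚ ∑ℚ (applyUpTo (h ∘ suc) n) f                    ≡⟨ cong (f (h 0) +ℚ_) (∑ℚ-applyUpTo (h ∘ suc) f n) ⟩
  f (h 0) +ℚ partialSum (f ∘ h ∘ suc) n                      ≡⟨ cong (_+ℚ partialSum (f ∘ h ∘ suc) n) (ℚ.+-identityˡ (f (h 0))) ⟨
  partialSum (f ∘ h) 1 +ℚ partialSum (f ∘ h ∘ suc) n         ≡⟨ partialSum-++ (f ∘ h) 1 n ⟨
  partialSum (f ∘ h) (suc n)                                 ∎

∑ℚ-partialSum : ∀ (xs : List A) n (f : A → ℕ → ℚ) →
  ∑ℚ xs (λ x → partialSum (f x) n) ≡ partialSum (λ i → ∑ℚ xs (λ x → f x i)) n
∑ℚ-partialSum xs zero    f = ∑ℚ-zero xs (λ _ → refl)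
∑ℚ-partialSum xs (suc n) f = trans (∑ℚ-+ xs _ _) (cong (_+ℚ ∑ℚ xs (λ x → f x n)) (∑ℚ-partialSum xs n f))

partialSum-swap : ∀ m n (f : ℕ → ℕ → ℚ) →
  partialSum (λ i → partialSum (f i) n) m ≡ partialSum (λ j → partialSum (λ i → f i j) m) n
partialSum-swap m n f = begin
  partialSum (λ i → partialSum (f i) n) m                    ≡⟨ ∑ℚ-applyUpTo (λ i → i) _ m ⟨
  ∑ℚ (applyUpTo (λ i → i) m) (λ i → partialSum (f i) n)      ≡⟨ ∑ℚ-partialSum (applyUpTo (λ i → i) m) n f ⟩
  partialSum (λ j → ∑ℚ (applyUpTo (λ i → i) m) (λ i → f i j)) n
    ≡⟨ partialSum-cong n (λ {j} _ → ∑ℚ-applyUpTo (λ i → i) (λ i → f i j) m) ⟩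
  partialSum (λ j → partialSum (λ i → f i j) m) n            ∎

-- Signed sums over subsets of an interval

-1^ : ℕ → ℚ
-1^ zero    = 1ℚ
-1^ (suc n) = - -1^ n

subsets : ℕ → List (List ℕ)
subsets k = subsequences (applyDownFrom suc k)

-- The sum of (-1)^|S| φ (∑ S) over the subsets S of {r + 1, …, r + t}: the coefficient
-- extraction φ applied to (1 - q^(r + 1)) ⋯ (1 - q^(r + t)). Multiplication by q^a becomes
-- the precomposition of φ with a +_.
signedSum : ℕ → ℕ → (ℕ → ℚ) → ℚ
signedSum r zero    φ = φ 0
signedSum r (suc t) φ = signedSum r t φ - signedSum r t (φ ∘ (suc (r + t) +_))

signedSum-cong : ∀ r t {φ ψ} → (∀ x → φ x ≡ ψ x) → signedSum r t φ ≡ signedSum r t ψ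
signedSum-cong r zero    h = h 0
signedSum-cong r (suc t) h = cong₂ _-_ (signedSum-cong r t h) (signedSum-cong r t (λ x → h (suc (r + t) + x)))

-- Every nonempty subset of {r + 1, ..., r + t} has sum above `r`, so only the empty one
-- contributes. This is the truncated form of P_r → 1.
signedSum-supported : ∀ r t φ → (∀ x → r ℕ.< x → φ x ≡ 0ℚ) → signedSum r t φ ≡ φ 0
signedSum-supported r zero    φ h = refl
signedSum-supported r (suc t) φ h = begin
  signedSum r t φ - signedSum r t (φ ∘ (suc (r + t) +_))
    ≡⟨ cong₂ _-_ (signedSum-supported r t φ h)
         (signedSum-supported r t (φ ∘ (suc (r + t) +_)) λ x _ → h _ (large x)) ⟩
  φ 0 - φ (suc (r + t) + 0)   ≡⟨ cong (λ y → φ 0 - y) (h _ (large 0)) ⟩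
  φ 0 - 0ℚ                    ≡⟨ ℚ.+-identityʳ (φ 0) ⟩
  φ 0                         ∎
  where
  large : ∀ x → r ℕ.< suc (r + t) + x
  large x = s≤s (ℕ.≤-trans (ℕ.m≤m+n r t) (ℕ.m≤m+n (r + t) x))

signedSum-zero : ∀ r t φ → (∀ x → φ x ≡ 0ℚ) → signedSum r t φ ≡ 0ℚ
signedSum-zero r t φ h = trans (signedSum-supported r t φ (λ x _ → h x)) (h 0)

-- The recursion of `signedSum` splits off the greatest factor; splitting off 1 - q^(r + 1) instead
-- makes products over neighbouring intervals comparable. With the induction hypothesis on both
-- halves, only two shifts remain to be commuted.
signedSum-least : ∀ r t φ →
  signedSum r (suc t) φ ≡ signedSum (suc r) t φ - signedSum (suc r) t (φ ∘ (suc r +_))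
signedSum-least r zero    φ = cong (λ a → φ 0 - φ (suc a + 0)) (ℕ.+-identityʳ r)
signedSum-least r (suc t) φ = begin
  signedSum r (suc t) φ - signedSum r (suc t) (φ ∘ (a +_))
    ≡⟨ cong₂ _-_ (signedSum-least r t φ) (signedSum-least r t (φ ∘ (a +_))) ⟩
  (S φ - S (φ ∘ (suc r +_))) - (S (φ ∘ (a +_)) - S (λ x → φ (a + (suc r + x))))
    ≡⟨ cong₂ (λ y z → (S φ - S (φ ∘ (suc r +_))) - (y - z))
         (signedSum-cong (suc r) t λ x → cong (λ b → φ (b + x)) a≡b)
         (signedSum-cong (suc r) t λ x → cong φ (trans (shuffle a (suc r) x) (cong (λ c → suc r + (c + x)) a≡b))) ⟩
  (S φ - S (φ ∘ (suc r +_))) - (S (φ ∘ (b +_)) - S (λ x → φ (suc r + (b + x))))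
    ≡⟨ solve 4 (λ w x y z → (w :- x) :- (y :- z) := (w :- y) :- (x :- z)) refl
         (S φ) (S (φ ∘ (suc r +_))) (S (φ ∘ (b +_))) (S (λ x → φ (suc r + (b + x)))) ⟩
  (S φ - S (φ ∘ (b +_))) - (S (φ ∘ (suc r +_)) - S (λ x → φ (suc r + (b + x)))) ∎
  where
  S = signedSum (suc r) t
  a = suc (r + suc t)
  b = suc (suc r + t)
  a≡b : a ≡ b
  a≡b = cong suc (ℕ.+-suc r t)
  shuffle : ∀ u v x → u + (v + x) ≡ v + (u + x)
  shuffle u v x = trans (sym (ℕ.+-assoc u v x)) (trans (cong (_+ x) (ℕ.+-comm u v)) (ℕ.+-assoc v u x))

∑-subsets-suc : ∀ k f → ∑ℚ (subsets (suc k)) f ≡ ∑ℚ (subsets k) (f ∘ (suc k ∷_)) +ℚ ∑ℚ (subsets k) f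
∑-subsets-suc k f = trans (∑ℚ-++ (map (suc k ∷_) (subsets k)) (subsets k) f)
  (cong (_+ℚ ∑ℚ (subsets k) f) (∑ℚ-map (suc k ∷_) (subsets k) f))

-- Iterates `∑-subsets-suc`: below a largest element `suc k`, the remaining elements form an
-- arbitrary subset of {1, ..., k}.
∑-subsets-by-largest : ∀ n f →
  ∑ℚ (subsets n) f ≡ partialSum (λ k → ∑ℚ (subsets k) (f ∘ (suc k ∷_))) n +ℚ f []
∑-subsets-by-largest zero    f = ℚ.+-comm (f []) 0ℚ
∑-subsets-by-largest (suc n) f = begin
  ∑ℚ (subsets (suc n)) f                   ≡⟨ ∑-subsets-suc n f ⟩
  u +ℚ ∑ℚ (subsets n) f                    ≡⟨ cong (u +ℚ_) (∑-subsets-by-largest n f) ⟩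
  u +ℚ (v +ℚ f [])                         ≡⟨ solve 3 (λ u v w → u :+ (v :+ w) := (v :+ u) :+ w) refl u v (f []) ⟩
  v +ℚ u +ℚ f []                           ∎
  where
  u = ∑ℚ (subsets n) (f ∘ (suc n ∷_))
  v = partialSum (λ k → ∑ℚ (subsets k) (f ∘ (suc k ∷_))) n

-- The indicator cuts {1, ..., r + t} down to {r + 1, ..., r + t}. For `t` = 0 every element
-- violates it, so `[]` alone survives; the element added in the step satisfies it, so it only flips
-- the sign and shifts `φ`.
∑-subsets-above : ∀ r t φ →
  ∑ℚ (subsets (r + t)) (λ ρ → φ (sum ρ) *ℚ (-1^ (# ρ) *ℚ χ (all? (r ℕ.<?_) ρ))) ≡ signedSum r t φ
∑-subsets-above r zero φ = begin
  ∑ℚ (subsets (r + 0)) f                                            ≡⟨ cong (λ k → ∑ℚ (subsets k) f) (ℕ.+-identityʳ r) ⟩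
  ∑ℚ (subsets r) f                                                  ≡⟨ ∑-subsets-by-largest r f ⟩
  partialSum (λ k → ∑ℚ (subsets k) (f ∘ (suc k ∷_))) r +ℚ f []      ≡⟨ cong₂ _+ℚ_ vanish f[] ⟩
  0ℚ +ℚ φ 0                                                         ≡⟨ ℚ.+-identityˡ (φ 0) ⟩
  φ 0                                                               ∎
  where
  f : List ℕ → ℚ
  f ρ = φ (sum ρ) *ℚ (-1^ (# ρ) *ℚ χ (all? (r ℕ.<?_) ρ))
  f[] : f [] ≡ φ 0
  f[] = ℚ.*-identityʳ (φ 0)
  vanish : partialSum (λ k → ∑ℚ (subsets k) (f ∘ (suc k ∷_))) r ≡ 0ℚ
  vanish = partialSum-zero r λ {k} k<r → ∑ℚ-zero (subsets k) λ {ρ} _ → begin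
    φ (suc k + sum ρ) *ℚ (-1^ (suc (# ρ)) *ℚ χ (all? (r ℕ.<?_) (suc k ∷ ρ)))
      ≡⟨ cong (λ y → φ (suc k + sum ρ) *ℚ (-1^ (suc (# ρ)) *ℚ y))
           (χ-false (all? (r ℕ.<?_) (suc k ∷ ρ)) λ { (r<1+k ∷ _) → ℕ.<⇒≱ r<1+k k<r }) ⟩
    φ (suc k + sum ρ) *ℚ (-1^ (suc (# ρ)) *ℚ 0ℚ)   ≡⟨ cong (φ (suc k + sum ρ) *ℚ_) (ℚ.*-zeroʳ (-1^ (suc (# ρ)))) ⟩
    φ (suc k + sum ρ) *ℚ 0ℚ                        ≡⟨ ℚ.*-zeroʳ (φ (suc k + sum ρ)) ⟩
    0ℚ                                             ∎
∑-subsets-above r (suc t) φ = begin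
  ∑ℚ (subsets (r + suc t)) (f φ)                                       ≡⟨ cong (λ k → ∑ℚ (subsets k) (f φ)) (ℕ.+-suc r t) ⟩
  ∑ℚ (subsets (suc (r + t))) (f φ)                                     ≡⟨ ∑-subsets-suc (r + t) (f φ) ⟩
  ∑ℚ (subsets (r + t)) (f φ ∘ (a ∷_)) +ℚ ∑ℚ (subsets (r + t)) (f φ)
    ≡⟨ cong (_+ℚ ∑ℚ (subsets (r + t)) (f φ)) (∑ℚ-cong (subsets (r + t)) (λ {ρ} _ → insert ρ)) ⟩
  ∑ℚ (subsets (r + t)) (λ ρ → - 1ℚ *ℚ f (φ ∘ (a +_)) ρ) +ℚ ∑ℚ (subsets (r + t)) (f φ)
    ≡⟨ cong (_+ℚ ∑ℚ (subsets (r + t)) (f φ)) (∑ℚ-*ˡ (subsets (r + t)) (- 1ℚ) (f (φ ∘ (a +_)))) ⟩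
  - 1ℚ *ℚ ∑ℚ (subsets (r + t)) (f (φ ∘ (a +_))) +ℚ ∑ℚ (subsets (r + t)) (f φ)
    ≡⟨ cong₂ (λ y z → - 1ℚ *ℚ y +ℚ z) (∑-subsets-above r t (φ ∘ (a +_))) (∑-subsets-above r t φ) ⟩
  - 1ℚ *ℚ signedSum r t (φ ∘ (a +_)) +ℚ signedSum r t φ
    ≡⟨ solve 2 (λ y z → con (- 1ℚ) :* y :+ z := z :- y) refl (signedSum r t (φ ∘ (a +_))) (signedSum r t φ) ⟩
  signedSum r (suc t) φ                                                ∎
  where
  a = suc (r + t)
  f : (ℕ → ℚ) → List ℕ → ℚ
  f φ ρ = φ (sum ρ) *ℚ (-1^ (# ρ) *ℚ χ (all? (r ℕ.<?_) ρ))
  insert : ∀ ρ → f φ (a ∷ ρ) ≡ - 1ℚ *ℚ f (φ ∘ (a +_)) ρ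
  insert ρ = trans
    (cong (λ y → φ (a + sum ρ) *ℚ (- -1^ (# ρ) *ℚ y))
      (χ-cong (all? (r ℕ.<?_) (a ∷ ρ)) (all? (r ℕ.<?_) ρ) (λ { (_ ∷ h) → h }) (s≤s (ℕ.m≤m+n r t) ∷_)))
    (solve 3 (λ x y z → x :* (:- y :* z) := con (- 1ℚ) :* (x :* (y :* z))) refl
      (φ (a + sum ρ)) (-1^ (# ρ)) (χ (all? (r ℕ.<?_) ρ)))

-- The telescoping sum

-- Coefficient extraction from ∑_{r < R} q^r (1 - q^(r + 1)) ⋯ (1 - q^(r + p)): with m = p + 1, the
-- series to be telescoped, cut off at `R` and stripped of its factor q^m.
windowSum : ℕ → ℕ → (ℕ → ℚ) → ℚ
windowSum p R φ = partialSum (λ r → signedSum r p (φ ∘ (r +_))) R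

windowSum-shift : ∀ p R φ →
  windowSum p R φ ≡ (signedSum R p φ - signedSum R p (φ ∘ (R +_))) +ℚ windowSum p R (φ ∘ (suc p +_))
windowSum-shift p zero    φ = sym (trans (ℚ.+-identityʳ _) (ℚ.+-inverseʳ (signedSum 0 p φ)))
windowSum-shift p (suc R) φ = begin
  windowSum p R φ +ℚ y                    ≡⟨ cong (_+ℚ y) (windowSum-shift p R φ) ⟩
  (x - y) +ℚ v +ℚ y                       ≡⟨ solve 4 (λ x y z v → ((x :- y) :+ v) :+ y := (x :- z) :+ (v :+ z)) refl x y z v ⟩
  -- `x - z` is by definition `signedSum R (suc p) φ`, that is P_R, and `z` is the summand that the
  -- shifted window gains at r = `R`.
  (x - z) +ℚ (v +ℚ z)                     ≡⟨ cong₂ (λ d e → d +ℚ (v +ℚ e)) (signedSum-least R p φ) (signedSum-cong R p λ i → cong φ (shuffle i)) ⟩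
  (signedSum (suc R) p φ - signedSum (suc R) p (φ ∘ (suc R +_))) +ℚ windowSum p (suc R) (φ ∘ (suc p +_)) ∎
  where
  x = signedSum R p φ
  y = signedSum R p (φ ∘ (R +_))
  z = signedSum R p (φ ∘ (suc (R + p) +_))
  v = windowSum p R (φ ∘ (suc p +_))
  shuffle : ∀ i → suc (R + p) + i ≡ suc p + (R + i)
  shuffle i = cong suc (trans (cong (_+ i) (ℕ.+-comm R p)) (ℕ.+-assoc p R i))

-- `signedSum-least` refolds the boundary term at `suc R` into P_R, which acts as the constant 1 on
-- a `φ` supported in {0, ..., R}.
windowSum-supported : ∀ p R φ → (∀ x → R ℕ.< x → φ x ≡ 0ℚ) →
  windowSum p (suc R) φ ≡ φ 0 +ℚ windowSum p (suc R) (φ ∘ (suc p +_))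
windowSum-supported p R φ h = trans (windowSum-shift p (suc R) φ)
  (cong (_+ℚ windowSum p (suc R) (φ ∘ (suc p +_)))
    (trans (sym (signedSum-least R p φ)) (signedSum-supported R (suc p) φ h)))

windowSum-cong : ∀ p R {φ ψ} → (∀ x → φ x ≡ ψ x) → windowSum p R φ ≡ windowSum p R ψ
windowSum-cong p R h = partialSum-cong R λ {r} _ → signedSum-cong r p λ x → h (r + x)

-- This is the coefficient of q^n in 1 / (1 - q^(p + 1)); the cutoff does not affect coefficients up
-- to q^R. Strong induction passes from n to n - (p + 1). For n ≤ p only the constant term is left,
-- and p + 1 divides n only if n = 0.
windowSum-≡ : ∀ p R n → n ℕ.≤ R → windowSum p (suc R) (λ x → χ (x ℕ.≟ n)) ≡ χ (suc p ∣? n)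
windowSum-≡ p R = <-rec _ step
  where
  step : ∀ n → (∀ {m} → m ℕ.< n → m ℕ.≤ R → windowSum p (suc R) (λ x → χ (x ℕ.≟ m)) ≡ χ (suc p ∣? m)) →
    n ℕ.≤ R → windowSum p (suc R) (λ x → χ (x ℕ.≟ n)) ≡ χ (suc p ∣? n)
  step n rec n≤R = trans (windowSum-supported p R (λ x → χ (x ℕ.≟ n)) support) rest
    where
    support : ∀ x → R ℕ.< x → χ (x ℕ.≟ n) ≡ 0ℚ
    support x R<x = χ-false (x ℕ.≟ n) λ { refl → ℕ.<⇒≱ R<x n≤R }
    rest : χ (0 ℕ.≟ n) +ℚ windowSum p (suc R) (λ x → χ (suc p + x ℕ.≟ n)) ≡ χ (suc p ∣? n)
    rest with suc p ℕ.≤? n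
    ... | no p≮n = trans (cong₂ _+ℚ_ χ0 vanish) (ℚ.+-identityʳ _)
      where
      vanish : windowSum p (suc R) (λ x → χ (suc p + x ℕ.≟ n)) ≡ 0ℚ
      vanish = partialSum-zero (suc R) λ {r} _ → signedSum-zero r p _ λ x →
        χ-false (suc p + (r + x) ℕ.≟ n) λ eq → p≮n (subst (suc p ℕ.≤_) eq (ℕ.m≤m+n (suc p) (r + x)))
      small : ∀ n → ¬ suc p ℕ.≤ n → suc p ∣ n → 0 ≡ n
      small zero    _   _   = refl
      small (suc n) p≮n p∣n = contradiction p∣n (>⇒∤ (ℕ.≰⇒> p≮n))
      χ0 : χ (0 ℕ.≟ n) ≡ χ (suc p ∣? n)
      χ0 = χ-cong (0 ℕ.≟ n) (suc p ∣? n) (λ { refl → suc p ∣0 }) (small n p≮n)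
    ... | yes p<n with ℕ.m≤n⇒∃[o]m+o≡n p<n
    ...   | m , refl = begin
      χ (0 ℕ.≟ n) +ℚ windowSum p (suc R) (λ x → χ (suc p + x ℕ.≟ suc p + m))
        ≡⟨ cong₂ _+ℚ_ (χ-false (0 ℕ.≟ n) λ ())
             (windowSum-cong p (suc R) λ x →
               χ-cong (suc p + x ℕ.≟ suc p + m) (x ℕ.≟ m) (ℕ.+-cancelˡ-≡ (suc p) x m) (cong (suc p +_))) ⟩
      0ℚ +ℚ windowSum p (suc R) (λ x → χ (x ℕ.≟ m))   ≡⟨ ℚ.+-identityˡ _ ⟩
      windowSum p (suc R) (λ x → χ (x ℕ.≟ m))         ≡⟨ rec (s≤s (ℕ.m≤n+m m p)) (ℕ.≤-trans (ℕ.m≤n+m m (suc p)) n≤R) ⟩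
      χ (suc p ∣? m)
        ≡⟨ χ-cong (suc p ∣? m) (suc p ∣? (suc p + m)) (∣m∣n⇒∣m+n ∣-refl) (λ d → ∣m+n∣m⇒∣n d ∣-refl) ⟩
      χ (suc p ∣? (suc p + m))                        ∎

-- The combinatorial identity

-- With L = k + 1, the arguments m = L - s + j are those with L - s < m ≤ L. For p = m - 1 this
-- reads p ≤ k and k - p < s; the first condition is stated separately because the truncated `k ∸ p`
-- is 0 for all p > k. The common range p < n prepares the exchange of sums.
∑-consecutive : ∀ k n s (g : ℕ → ℚ) → s ℕ.≤ suc k → k ℕ.< n →
  ∑ℚ [1⋯ s ] (λ j → g (suc k ∸ s + j)) ≡
  partialSum (λ p → (χ (p ℕ.≤? k) *ℚ χ (k ∸ p ℕ.<? s)) *ℚ g (suc p)) n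
∑-consecutive k n s g s≤1+k k<n = begin
  ∑ℚ [1⋯ s ] (λ j → g (a + j))               ≡⟨ ∑ℚ-applyUpTo suc (λ j → g (a + j)) s ⟩
  partialSum (λ i → g (a + suc i)) s         ≡⟨ partialSum-cong s (λ i<s → sym (inside i<s)) ⟩
  partialSum (F ∘ (a +_)) s                  ≡⟨ ℚ.+-identityˡ _ ⟨
  0ℚ +ℚ partialSum (F ∘ (a +_)) s            ≡⟨ cong (_+ℚ partialSum (F ∘ (a +_)) s) (partialSum-zero a below) ⟨
  partialSum F a +ℚ partialSum (F ∘ (a +_)) s  ≡⟨ partialSum-++ F a s ⟨
  partialSum F (a + s)                       ≡⟨ cong (partialSum F) a+s ⟩
  partialSum F (suc k)                       ≡⟨ ℚ.+-identityʳ _ ⟨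
  partialSum F (suc k) +ℚ 0ℚ                 ≡⟨ cong (partialSum F (suc k) +ℚ_) (partialSum-zero (n ∸ suc k) above) ⟨
  partialSum F (suc k) +ℚ partialSum (F ∘ (suc k +_)) (n ∸ suc k)  ≡⟨ partialSum-++ F (suc k) (n ∸ suc k) ⟨
  partialSum F (suc k + (n ∸ suc k))         ≡⟨ cong (partialSum F) (ℕ.m+[n∸m]≡n k<n) ⟩
  partialSum F n                             ∎
  where
  a = suc k ∸ s
  a+s : a + s ≡ suc k
  a+s = ℕ.m∸n+n≡m s≤1+k
  F : ℕ → ℚ
  F p = (χ (p ℕ.≤? k) *ℚ χ (k ∸ p ℕ.<? s)) *ℚ g (suc p)
  weight : ∀ p {u v} → χ (p ℕ.≤? k) ≡ u → χ (k ∸ p ℕ.<? s) ≡ v → F p ≡ u *ℚ v *ℚ g (suc p)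
  weight p eq₁ eq₂ = cong₂ (λ u v → u *ℚ v *ℚ g (suc p)) eq₁ eq₂
  inside : ∀ {i} → i ℕ.< s → F (a + i) ≡ g (a + suc i)
  inside {i} i<s = trans
    (weight (a + i)
      (χ-true (a + i ℕ.≤? k) (s≤s⁻¹ (subst (suc (a + i) ℕ.≤_) a+s (ℕ.+-monoʳ-< a i<s))))
      (χ-true (k ∸ (a + i) ℕ.<? s) (ℕ.m<n+o⇒m∸n<o k (a + i) {{ℕ.>-nonZero (ℕ.≤-trans (s≤s z≤n) i<s)}}
        (ℕ.≤-trans (ℕ.≤-reflexive (sym a+s)) (ℕ.+-monoˡ-≤ s (ℕ.m≤m+n a i))))))
    (trans (ℚ.*-identityˡ (g (suc (a + i)))) (cong g (sym (ℕ.+-suc a i))))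
  below : ∀ {p} → p ℕ.< a → F p ≡ 0ℚ
  below {p} p<a = trans
    (weight p refl (χ-false (k ∸ p ℕ.<? s) (ℕ.≤⇒≯ (ℕ.m+n≤o⇒m≤o∸n s (s≤s⁻¹
      (subst₂ ℕ._≤_ (ℕ.+-suc s p) (trans (ℕ.+-comm s a) a+s) (ℕ.+-monoʳ-≤ s p<a)))))))
    (trans (cong (_*ℚ g (suc p)) (ℚ.*-zeroʳ (χ (p ℕ.≤? k)))) (ℚ.*-zeroˡ (g (suc p))))
  above : ∀ {i} → i ℕ.< n ∸ suc k → F (suc k + i) ≡ 0ℚ
  above {i} _ = trans
    (weight (suc k + i) (χ-false (suc k + i ℕ.≤? k) (λ h → ℕ.<⇒≱ (ℕ.m≤m+n (suc k) i) h)) refl)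
    (trans (cong (_*ℚ g (suc (suc k + i))) (ℚ.*-zeroˡ (χ (k ∸ (suc k + i) ℕ.<? s))))
      (ℚ.*-zeroˡ (g (suc (suc k + i)))))

largest : ∀ {L ρ} → All (ℕ._≤ L) ρ → ℓ (L ∷ ρ) ≡ L
largest {L} {ρ} ρ≤L = ℕ.≤-antisym (max≤v⁺ z≤n (ℕ.≤-refl ∷ ρ≤L))
  (v≤max⁺ 0 (L ∷ ρ) (inj₂ (here ℕ.≤-refl)))

-- The contribution of the partition π = `suc k ∷ ρ`, with weight `w`; since `# π ∸ 1` is `# ρ`, the
-- sign is that of `ρ`.
term : ℕ → (List ℕ → ℚ) → ℕ → List ℕ → ℚ
term n w k ρ = χ (suc k + sum ρ ℕ.≟ n) *ℚ (-1^ (# ρ) *ℚ w ρ)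

-- Put k = p + r. The condition on the smallest part then says that all parts of `ρ` exceed `r`, so
-- `ρ` runs over the subsets of {r + 1, ..., r + p}. With n = p + 1 + d, the condition on the total
-- becomes r + `sum ρ` = d, and the sum over r is a `windowSum`.
coefficient : ∀ n p → p ℕ.< n →
  partialSum (λ k → χ (p ℕ.≤? k) *ℚ
    ∑ℚ (subsets k) (term n (λ ρ → χ (k ∸ p ℕ.<? s (suc k ∷ ρ))) k)) n
  ≡ χ (suc p ∣? n)
coefficient n p p<n with ℕ.m≤n⇒∃[o]m+o≡n p<n
... | d , refl = begin
  partialSum F (suc p + d)                             ≡⟨ cong (partialSum F) (ℕ.+-suc p d) ⟨
  partialSum F (p + suc d)                             ≡⟨ partialSum-++ F p (suc d) ⟩
  partialSum F p +ℚ partialSum (F ∘ (p +_)) (suc d)    ≡⟨ cong₂ _+ℚ_ (partialSum-zero p low) (partialSum-cong (suc d) (λ {r} _ → high r)) ⟩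
  0ℚ +ℚ windowSum p (suc d) (λ x → χ (x ℕ.≟ d))        ≡⟨ ℚ.+-identityˡ _ ⟩
  -- The range k < n leaves exactly the r ≤ d, just enough for the exponent `d`.
  windowSum p (suc d) (λ x → χ (x ℕ.≟ d))              ≡⟨ windowSum-≡ p d d ℕ.≤-refl ⟩
  χ (suc p ∣? d)                                       ≡⟨ χ-cong (suc p ∣? d) (suc p ∣? (suc p + d)) (∣m∣n⇒∣m+n ∣-refl) (λ e → ∣m+n∣m⇒∣n e ∣-refl) ⟩
  χ (suc p ∣? (suc p + d))                             ∎
  where
  S : ℕ → ℚ
  S k = ∑ℚ (subsets k) (term (suc p + d) (λ ρ → χ (k ∸ p ℕ.<? s (suc k ∷ ρ))) k)
  F : ℕ → ℚ
  F k = χ (p ℕ.≤? k) *ℚ S k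
  low : ∀ {k} → k ℕ.< p → F k ≡ 0ℚ
  low {k} k<p = trans (cong (_*ℚ S k) (χ-false (p ℕ.≤? k) (ℕ.<⇒≱ k<p))) (ℚ.*-zeroˡ (S k))
  above : ∀ r ρ → χ (p + r ∸ p ℕ.<? s (suc (p + r) ∷ ρ)) ≡ χ (all? (r ℕ.<?_) ρ)
  above r ρ = χ-cong (p + r ∸ p ℕ.<? s (suc (p + r) ∷ ρ)) (all? (r ℕ.<?_) ρ)
    (λ h → All.map (ℕ.<-≤-trans (subst (ℕ._< s (suc (p + r) ∷ ρ)) (ℕ.m+n∸m≡n p r) h)) (min≤xs (suc (p + r)) ρ))
    (λ h → subst (ℕ._< s (suc (p + r) ∷ ρ)) (sym (ℕ.m+n∸m≡n p r)) (v<min⁺ (s≤s (ℕ.m≤n+m r p)) h))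
  total : ∀ r x → χ (suc (p + r) + x ℕ.≟ suc p + d) ≡ χ (r + x ℕ.≟ d)
  total r x = χ-cong (suc (p + r) + x ℕ.≟ suc p + d) (r + x ℕ.≟ d)
    (λ e → ℕ.+-cancelˡ-≡ (suc p) (r + x) d (trans (sym (ℕ.+-assoc (suc p) r x)) e))
    (λ e → trans (ℕ.+-assoc (suc p) r x) (cong (suc p +_) e))
  high : ∀ r → F (p + r) ≡ signedSum r p (λ x → χ (r + x ℕ.≟ d))
  high r = begin
    F (p + r)    ≡⟨ cong (_*ℚ S (p + r)) (χ-true (p ℕ.≤? p + r) (ℕ.m≤m+n p r)) ⟩
    1ℚ *ℚ S (p + r)  ≡⟨ ℚ.*-identityˡ (S (p + r)) ⟩
    S (p + r)
      ≡⟨ ∑ℚ-cong (subsets (p + r)) (λ {ρ} _ → cong₂ (λ u v → u *ℚ (-1^ (# ρ) *ℚ v)) (total r (sum ρ)) (above r ρ)) ⟩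
    ∑ℚ (subsets (p + r)) f  ≡⟨ cong (λ k → ∑ℚ (subsets k) f) (ℕ.+-comm p r) ⟩
    ∑ℚ (subsets (r + p)) f  ≡⟨ ∑-subsets-above r p (λ x → χ (r + x ℕ.≟ d)) ⟩
    signedSum r p (λ x → χ (r + x ℕ.≟ d)) ∎
    where
    f : List ℕ → ℚ
    f ρ = χ (r + sum ρ ℕ.≟ d) *ℚ (-1^ (# ρ) *ℚ χ (all? (r ℕ.<?_) ρ))

∑-𝒟≡∑-divisors : ∀ n .{{_ : NonZero n}} (g : ℕ → ℚ) →
  ∑ℚ (𝒟 n) (λ π → -1^ (# π ∸ 1) *ℚ ∑ℚ [1⋯ s π ] (λ j → g (ℓ π ∸ s π + j))) ≡ ∑ℚ (divisors n) g
∑-𝒟≡∑-divisors n g = begin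
  ∑ℚ (𝒟 n) h                                                ≡⟨ ∑ℚ-filter (λ π → sum π ℕ.≟ n) (subsets n) h ⟩
  ∑ℚ (subsets n) H                                          ≡⟨ ∑-subsets-by-largest n H ⟩
  partialSum (λ k → ∑ℚ (subsets k) (H ∘ (suc k ∷_))) n +ℚ H []
    ≡⟨ cong₂ _+ℚ_ (partialSum-cong n by-coefficients) H[] ⟩
  partialSum (λ k → partialSum (λ p → c k p *ℚ g (suc p)) n) n +ℚ 0ℚ
    ≡⟨ ℚ.+-identityʳ _ ⟩
  partialSum (λ k → partialSum (λ p → c k p *ℚ g (suc p)) n) n
    -- After the exchange, the inner sum over `k` is the full coefficient of `g (suc p)`.
    ≡⟨ partialSum-swap n n (λ k p → c k p *ℚ g (suc p)) ⟩
  partialSum (λ p → partialSum (λ k → c k p *ℚ g (suc p)) n) n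
    ≡⟨ partialSum-cong n (λ {p} p<n → trans (partialSum-*ʳ n (λ k → c k p) (g (suc p)))
         (cong (_*ℚ g (suc p)) (coefficient n p p<n))) ⟩
  partialSum (λ p → χ (suc p ∣? n) *ℚ g (suc p)) n          ≡⟨ ∑ℚ-applyUpTo suc (λ d → χ (d ∣? n) *ℚ g d) n ⟨
  ∑ℚ [1⋯ n ] (λ d → χ (d ∣? n) *ℚ g d)                      ≡⟨ ∑ℚ-filter (_∣? n) [1⋯ n ] g ⟨
  ∑ℚ (divisors n) g                                         ∎
  where
  h H : List ℕ → ℚ
  h π = -1^ (# π ∸ 1) *ℚ ∑ℚ [1⋯ s π ] (λ j → g (ℓ π ∸ s π + j))
  H π = χ (sum π ℕ.≟ n) *ℚ h π
  w : ℕ → ℕ → List ℕ → ℚ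
  w k p ρ = χ (k ∸ p ℕ.<? s (suc k ∷ ρ))
  c : ℕ → ℕ → ℚ
  c k p = χ (p ℕ.≤? k) *ℚ ∑ℚ (subsets k) (term n (w k p) k)
  H[] : H [] ≡ 0ℚ
  -- On the empty list `s` and `ℓ` have default values; positivity of `n` keeps it out of the sum.
  H[] = trans (cong (_*ℚ h []) (χ-false (0 ℕ.≟ n) (λ e → ℕ.≢-nonZero⁻¹ n (sym e)))) (ℚ.*-zeroˡ (h []))
  expand : ∀ {k ρ} → k ℕ.< n → ρ ∈ subsets k →
    H (suc k ∷ ρ) ≡ partialSum (λ p → χ (p ℕ.≤? k) *ℚ g (suc p) *ℚ term n (w k p) k ρ) n
  expand {k} {ρ} k<n ρ∈ = begin
    x *ℚ (y *ℚ ∑ℚ [1⋯ m ] (λ j → g (ℓ (suc k ∷ ρ) ∸ m + j)))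
      -- Members of `subsets k` have parts at most `k`, so the prefixed `suc k` is the largest part.
      ≡⟨ cong (λ L → x *ℚ (y *ℚ ∑ℚ [1⋯ m ] (λ j → g (L ∸ m + j))))
           (largest (All.map (ℕ.m≤n⇒m≤1+n ∘ proj₂) (proj₂ (𝒟-Lemmas.subsequence⁻ k ρ∈)))) ⟩
    x *ℚ (y *ℚ ∑ℚ [1⋯ m ] (λ j → g (suc k ∸ m + j)))
      ≡⟨ cong (λ e → x *ℚ (y *ℚ e)) (∑-consecutive k n m g (min≤⊤ (suc k) ρ) k<n) ⟩
    x *ℚ (y *ℚ partialSum (λ p → (χ (p ℕ.≤? k) *ℚ w k p ρ) *ℚ g (suc p)) n)
      ≡⟨ solve 3 (λ x y e → x :* (y :* e) := e :* (x :* y)) refl x y _ ⟩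
    partialSum (λ p → (χ (p ℕ.≤? k) *ℚ w k p ρ) *ℚ g (suc p)) n *ℚ (x *ℚ y)
      ≡⟨ partialSum-*ʳ n (λ p → (χ (p ℕ.≤? k) *ℚ w k p ρ) *ℚ g (suc p)) (x *ℚ y) ⟨
    partialSum (λ p → ((χ (p ℕ.≤? k) *ℚ w k p ρ) *ℚ g (suc p)) *ℚ (x *ℚ y)) n
      ≡⟨ partialSum-cong n (λ {p} _ → solve 5 (λ a b c x y → ((a :* b) :* c) :* (x :* y) := (a :* c) :* (x :* (y :* b)))
           refl (χ (p ℕ.≤? k)) (w k p ρ) (g (suc p)) x y) ⟩
    partialSum (λ p → χ (p ℕ.≤? k) *ℚ g (suc p) *ℚ term n (w k p) k ρ) n ∎
    where
    x = χ (suc k + sum ρ ℕ.≟ n)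
    y = -1^ (# ρ)
    m = s (suc k ∷ ρ)
  by-coefficients : ∀ {k} → k ℕ.< n →
    ∑ℚ (subsets k) (H ∘ (suc k ∷_)) ≡ partialSum (λ p → c k p *ℚ g (suc p)) n
  by-coefficients {k} k<n = begin
    ∑ℚ (subsets k) (H ∘ (suc k ∷_))
      ≡⟨ ∑ℚ-cong (subsets k) (expand k<n) ⟩
    ∑ℚ (subsets k) (λ ρ → partialSum (λ p → χ (p ℕ.≤? k) *ℚ g (suc p) *ℚ term n (w k p) k ρ) n)
      ≡⟨ ∑ℚ-partialSum (subsets k) n (λ ρ p → χ (p ℕ.≤? k) *ℚ g (suc p) *ℚ term n (w k p) k ρ) ⟩
    partialSum (λ p → ∑ℚ (subsets k) (λ ρ → χ (p ℕ.≤? k) *ℚ g (suc p) *ℚ term n (w k p) k ρ)) n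
      ≡⟨ partialSum-cong n (λ {p} _ → trans
           (∑ℚ-*ˡ (subsets k) (χ (p ℕ.≤? k) *ℚ g (suc p)) (term n (w k p) k))
           (solve 3 (λ a b e → (a :* b) :* e := (a :* e) :* b) refl
             (χ (p ℕ.≤? k)) (g (suc p)) (∑ℚ (subsets k) (term n (w k p) k)))) ⟩
    partialSum (λ p → c k p *ℚ g (suc p)) n ∎

-- Componentwise reduction to rational sums

-- No limit argument arises: when the approximations agree at every index, the threshold 0 serves
-- every ε.
≡⇒≈ℝ : ∀ x y → (∀ k → seq x k ≡ seq y k) → x ≈ℝ y
≡⇒≈ℝ x y h ε 0<ε = 0 , λ k _ → subst (ℚ._< ε)
  (cong ℚ.∣_∣ (trans (sym (ℚ.+-inverseʳ (seq y k))) (cong (_- seq y k) (sym (h k))))) 0<ε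

≡⇒≈ℂ : ∀ w v → (∀ k → seq (re w) k ≡ seq (re v) k) → (∀ k → seq (im w) k ≡ seq (im v) k) → w ≈ℂ v
≡⇒≈ℂ w v h₁ h₂ = ≡⇒≈ℝ (re w) (re v) h₁ , ≡⇒≈ℝ (im w) (im v) h₂

re-∑ : ∀ (xs : List A) (f : A → ℂ) k → seq (re (∑ xs f)) k ≡ ∑ℚ xs (λ x → seq (re (f x)) k)
re-∑ []       f k = refl
re-∑ (x ∷ xs) f k = cong (seq (re (f x)) k +ℚ_) (re-∑ xs f k)

im-∑ : ∀ (xs : List A) (f : A → ℂ) k → seq (im (∑ xs f)) k ≡ ∑ℚ xs (λ x → seq (im (f x)) k)
im-∑ []       f k = refl
im-∑ (x ∷ xs) f k = cong (seq (im (f x)) k +ℚ_) (im-∑ xs f k)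

-- Makes multiplication by `ε m` act on each approximation exactly as `-1^ m`: the imaginary part is
-- 0 at every index, not only in the limit. As a record it lets the power of -1 stay abstract.
record IsSign (ε : ℕ → ℂ) : Set where
  field
    re-≡ : ∀ m k → seq (re (ε m)) k ≡ -1^ m
    im-≡ : ∀ m k → seq (im (ε m)) k ≡ 0ℚ

-1^-approx : ∀ m k → seq (re ((-ℂ 1ℂ) ^ℂ m)) k ≡ -1^ m × seq (im ((-ℂ 1ℂ) ^ℂ m)) k ≡ 0ℚ
-1^-approx zero    k = refl , refl
-1^-approx (suc m) k with -1^-approx m k
... | eq₁ , eq₂ =
    -- The approximations of `-ℂ 1ℂ` have imaginary part `- 0ℚ`.
    trans (cong₂ (λ a b → - 1ℚ *ℚ a +ℚ - (- 0ℚ *ℚ b)) eq₁ eq₂)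
      (solve 1 (λ a → con (- 1ℚ) :* a :+ :- (con (- 0ℚ) :* con 0ℚ) := :- a) refl (-1^ m))
  , trans (cong₂ (λ a b → - 1ℚ *ℚ b +ℚ - 0ℚ *ℚ a) eq₁ eq₂)
      (solve 1 (λ a → con (- 1ℚ) :* con 0ℚ :+ con (- 0ℚ) :* a := con 0ℚ) refl (-1^ m))

re-signed-∑ : ∀ {ε} → IsSign ε → ∀ (xs : List A) (e : A → ℕ) (f : A → ℂ) k →
  seq (re (∑ xs (λ x → ε (e x) *ℂ f x))) k ≡ ∑ℚ xs (λ x → -1^ (e x) *ℚ seq (re (f x)) k)
re-signed-∑ {ε = ε} ε-sign xs e f k = trans (re-∑ xs (λ x → ε (e x) *ℂ f x) k)
  (∑ℚ-cong xs λ {x} _ → signed (e x) (f x))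
  where
  signed : ∀ m w → seq (re (ε m *ℂ w)) k ≡ -1^ m *ℚ seq (re w) k
  signed m w = trans
    (cong₂ (λ a b → a *ℚ seq (re w) k +ℚ - (b *ℚ seq (im w) k)) (IsSign.re-≡ ε-sign m k) (IsSign.im-≡ ε-sign m k))
    (solve 3 (λ a x y → a :* x :+ :- (con 0ℚ :* y) := a :* x) refl (-1^ m) (seq (re w) k) (seq (im w) k))

im-signed-∑ : ∀ {ε} → IsSign ε → ∀ (xs : List A) (e : A → ℕ) (f : A → ℂ) k →
  seq (im (∑ xs (λ x → ε (e x) *ℂ f x))) k ≡ ∑ℚ xs (λ x → -1^ (e x) *ℚ seq (im (f x)) k)
im-signed-∑ {ε = ε} ε-sign xs e f k = trans (im-∑ xs (λ x → ε (e x) *ℂ f x) k)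
  (∑ℚ-cong xs λ {x} _ → signed (e x) (f x))
  where
  signed : ∀ m w → seq (im (ε m *ℂ w)) k ≡ -1^ m *ℚ seq (im w) k
  signed m w = trans
    (cong₂ (λ a b → a *ℚ seq (im w) k +ℚ b *ℚ seq (re w) k) (IsSign.re-≡ ε-sign m k) (IsSign.im-≡ ε-sign m k))
    (solve 3 (λ a x y → a :* x :+ con 0ℚ :* y := a :* x) refl (-1^ m) (seq (im w) k) (seq (re w) k))

-- For each index `k` the rational identity is applied to the k-th approximations of `f m`, once for
-- real and once for imaginary parts. `f`, `g` and `inner` are linked by equations rather than by
-- definition, so that sums and powers may be kept abstract.
∑-𝒟≈∑-divisors : ∀ n .{{_ : NonZero n}} {ε} → IsSign ε → (f g : ℕ → ℂ) → (∀ m → f m ≡ g m) →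
  (inner : List ℕ → ℂ) → (∀ π → inner π ≡ ∑ [1⋯ s π ] (λ j → f (ℓ π ∸ s π + j))) →
  ∑ (𝒟 n) (λ π → ε (# π ∸ 1) *ℂ inner π) ≈ℂ ∑ (divisors n) g
∑-𝒟≈∑-divisors n {ε} ε-sign f g f≡g inner inner≡ = ≡⇒≈ℂ
  (∑ (𝒟 n) (λ π → ε (# π ∸ 1) *ℂ inner π)) (∑ (divisors n) g)
  (λ k → trans (re-signed-∑ ε-sign (𝒟 n) (λ π → # π ∸ 1) inner k) (trans
    (∑ℚ-cong (𝒟 n) λ {π} _ → cong (-1^ (# π ∸ 1) *ℚ_)
      (trans (cong (λ w → seq (re w) k) (inner≡ π)) (re-∑ [1⋯ s π ] (λ j → f (ℓ π ∸ s π + j)) k)))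
    (trans (∑-𝒟≡∑-divisors n (λ m → seq (re (f m)) k)) (trans
      (∑ℚ-cong (divisors n) (λ {d} _ → cong (λ w → seq (re w) k) (f≡g d)))
      (sym (re-∑ (divisors n) g k))))))
  (λ k → trans (im-signed-∑ ε-sign (𝒟 n) (λ π → # π ∸ 1) inner k) (trans
    (∑ℚ-cong (𝒟 n) λ {π} _ → cong (-1^ (# π ∸ 1) *ℚ_)
      (trans (cong (λ w → seq (im w) k) (inner≡ π)) (im-∑ [1⋯ s π ] (λ j → f (ℓ π ∸ s π + j)) k)))
    (trans (∑-𝒟≡∑-divisors n (λ m → seq (im (f m)) k)) (trans
      (∑ℚ-cong (divisors n) (λ {d} _ → cong (λ w → seq (im w) k) (f≡g d)))
      (sym (im-∑ (divisors n) g k))))))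

-- The aliases ∑-syntax and _^ℂ_ are elaborated differently in types and in terms, and
-- comparing the two forms inside an argument of _*ℂ_ unfolds the Cauchy proofs of exp.
-- Hence sums and powers stay abstract here.
record IsSumAndPower (S : List ℕ → (ℕ → ℂ) → ℂ) (_^_ : ℂ → ℕ → ℂ) : Set where
  field
    sum-≡   : ∀ xs f → S xs f ≡ ∑ xs f
    power-≡ : ∀ w m → w ^ m ≡ w ^ℂ m

isSumAndPower : IsSumAndPower ∑-syntax _^ℂ_
isSumAndPower = record { sum-≡ = λ _ _ → refl ; power-≡ = λ _ _ → refl }

∑-𝒟≈σ : ∀ {S _^_} → IsSumAndPower S _^_ → ∀ c z n .{{_ : NonZero n}} →
  ∑ (𝒟 n) (λ π → ((-ℂ 1ℂ) ^ (# π ∸ 1)) *ℂ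
    S [1⋯ s π ] (λ j → (ℓ π ∸ s π + j) ^ᶜ z *ℂ (c ^ (ℓ π ∸ s π + j)))) ≈ℂ σ z c n
∑-𝒟≈σ {S} {_^_} abstracted c z n = ∑-𝒟≈∑-divisors n -1-sign
  (λ m → m ^ᶜ z *ℂ (c ^ m)) (λ m → m ^ᶜ z *ℂ c ^ℂ m)
  (λ m → cong (m ^ᶜ z *ℂ_) {x = c ^ m} {y = c ^ℂ m} (power-≡ c m))
  (λ π → S [1⋯ s π ] (λ j → (ℓ π ∸ s π + j) ^ᶜ z *ℂ (c ^ (ℓ π ∸ s π + j))))
  (λ π → sum-≡ [1⋯ s π ] (λ j → (ℓ π ∸ s π + j) ^ᶜ z *ℂ (c ^ (ℓ π ∸ s π + j))))
  where
  open IsSumAndPower abstracted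
  -1-sign : IsSign ((-ℂ 1ℂ) ^_)
  -1-sign = record
    { re-≡ = λ m k → trans (cong (λ w → seq (re w) k) (power-≡ (-ℂ 1ℂ) m)) (proj₁ (-1^-approx m k))
    ; im-≡ = λ m k → trans (cong (λ w → seq (im w) k) (power-≡ (-ℂ 1ℂ) m)) (proj₂ (-1^-approx m k))
    }

theorem2p1 : (c z : ℂ) (n : ℕ) → .{{_ : NonZero n}} →
    ∑[ π ∈ 𝒟 n ] ((-ℂ 1ℂ) ^ℂ (# π ∸ 1) *ℂ (∑[ j ∈ [1⋯ s π ] ] ((ℓ π ∸ s π + j) ^ᶜ z *ℂ c ^ℂ (ℓ π ∸ s π + j))))
    ≈ℂ σ z c n
theorem2p1 c z n = ∑-𝒟≈σ isSumAndPower c z n
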